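{- Let $n\ge 1$, $m\geq 1$ and $k\geq 0$ be integers with $km \leq n$. The number of parking functions of length $n$ with exactly $k$ $m$-cycles is $$\sum_{\substack{\ell\ge 0\\ (k+\ell)m \leq n}} (-1)^{\ell}\, \frac{\left((m-1)!\right)^{k+\ell}}{k!\,\ell!} \binom{n+1}{m, \dots, m,\, n-(k+\ell)m+1} (n+1)^{n-(k+\ell)m-1},$$ where in the multinomial coefficient the entry $m$ is repeated $k+\ell$ times.
   Context: A parking function of length $n$ is a sequence $\pi=(\pi_1,\dots,\pi_n)$ of positive integers such that, if $\lambda_1\le\cdots\le\lambda_n$ is the weakly increasing rearrangement of $\pi_1,\dots,\pi_n$, then $\lambda_i\le i$ for all $1\le i\le n$. For $m\ge 1$, distinct indices $(i_1,\dots,i_m)$ in $\{1,\dots,n\}$ form an $m$-cycle of $\pi$ if $\pi_{i_1}=i_2,\ \pi_{i_2}=i_3,\dots,\pi_{i_{m-1}}=i_m,\ \pi_{i_m}=i_1$; tuples that differ by a cyclic rotation are regarded as the same $m$-cycle. For $m=1$ an $m$-cycle is a fixed point, i.e. an index $i$ with $\pi_i=i$. The multinomial coefficient with $k+\ell$ entries equal to $m$ is $\binom{n+1}{m,\dots,m,\,n-(k+\ell)m+1}=\frac{(n+1)!}{(m!)^{k+\ell}\,(n-(k+\ell)m+1)!}$. -}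

module Defs where

open import Data.Fin.Base using (Fin; toℕ)
open import Data.Integer.Base as ℤ using (ℤ; +_; -[1+_]; 1ℤ; -1ℤ)
open import Data.List.Base as List using (List; []; _∷_; [_]; _++_; foldr; replicate)
open import Data.List.Properties using (++-assoc; ++-identityʳ)
open import Data.List.Relation.Binary.Permutation.Propositional using (_↭_)
open import Data.List.Relation.Unary.All.Properties using () renaming (map⁺ to All-map⁺)
open import Data.List.Relation.Unary.All as ListAll using ()
open import Data.Nat.Base using (ℕ; zero; suc; _+_; _*_; _^_; _∸_; _!; _≤_; NonZero)
open import Data.Nat.GeneralisedArithmetic using (iterate)
open import Data.Nat.ListAction using (product)
open import Data.Nat.ListAction.Properties using (product≢0)
open import Data.Nat.Properties using (_!≢0; _!*_!≢0; m^n≢0)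
open import Data.Product.Base using (Σ-syntax; ∃-syntax; _×_; _,_; proj₁)
open import Data.Rational.Base as ℚ using (ℚ; 0ℚ; _/_)
open import Data.Vec.Base using (Vec; []; _∷_; _∷ʳ_; lookup; map; toList)
open import Data.Vec.Properties using (cast-is-id; toList-injective; toList-∷ʳ; length-toList)
open import Data.Vec.Relation.Unary.All using (All)
open import Data.Vec.Relation.Unary.Linked using (Linked)
open import Data.Vec.Relation.Unary.Unique.Propositional using (Unique)
open import Function.Base using (_∘_)
open import Function.Bundles using (Inverse)
open import Level using (0ℓ)
open import Relation.Binary.Bundles using (Setoid)
open import Relation.Binary.PropositionalEquality
  using (_≡_; refl; sym; trans; cong; module ≡-Reasoning)
import Relation.Binary.PropositionalEquality.Properties as ≡
import Relation.Binary.Construct.On as On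

private
  variable
    A : Set
    n m : ℕ

HasCardinality : Setoid 0ℓ 0ℓ → ℕ → Set
HasCardinality S N = Inverse (≡.setoid (Fin N)) S

IsParkingFunction : Vec ℕ n → Set
IsParkingFunction {n} π =
  All (1 ≤_) π ×
  ((λs : Vec ℕ n) → toList λs ↭ toList π → Linked _≤_ λs →
   (i : Fin n) → lookup λs i ≤ suc (toℕ i))

rotate : Vec A m → Vec A m
rotate []       = []
rotate (x ∷ xs) = xs ∷ʳ x

-- The position i : Fin n stands for the index suc (toℕ i) ∈ {1,…,n}.
-- Comparing (π_{i₁},…,π_{iₘ}) with the rotated tuple (i₂,…,iₘ,i₁) states all m
-- equations of a cycle at once.
IsCycle : Vec ℕ n → Vec (Fin n) m → Set
IsCycle π is = Unique is × map (lookup π) is ≡ map (suc ∘ toℕ) (rotate is)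

infix 4 _~_

_~_ : Vec A m → Vec A m → Set
xs ~ ys = ∃[ j ] iterate rotate xs j ≡ ys

private
  rotateList : List A → List A
  rotateList []       = []
  rotateList (x ∷ xs) = xs ++ [ x ]

  toList-iterate : (xs : Vec A m) → ∀ j →
    toList (iterate rotate xs j) ≡ iterate rotateList (toList xs) j
  toList-iterate xs       zero    = refl
  toList-iterate []       (suc j) = toList-iterate [] j
  toList-iterate (x ∷ xs) (suc j) = trans (toList-iterate (xs ∷ʳ x) j)
    (cong (λ ys → iterate rotateList ys j) (toList-∷ʳ x xs))

  rotateList-++ : (xs ys : List A) →
    iterate rotateList (xs ++ ys) (List.length xs) ≡ ys ++ xs
  rotateList-++ []       ys = sym (++-identityʳ ys)
  rotateList-++ (x ∷ xs) ys = begin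
    iterate rotateList ((xs ++ ys) ++ [ x ]) (List.length xs)
      ≡⟨ cong (λ zs → iterate rotateList zs (List.length xs)) (++-assoc xs ys [ x ]) ⟩
    iterate rotateList (xs ++ (ys ++ [ x ])) (List.length xs)
      ≡⟨ rotateList-++ xs (ys ++ [ x ]) ⟩
    (ys ++ [ x ]) ++ xs
      ≡⟨ ++-assoc ys [ x ] xs ⟩
    ys ++ x ∷ xs ∎
    where open ≡-Reasoning

  rotate-full : (xs : Vec A m) → iterate rotate xs m ≡ xs
  rotate-full {m = m} xs = trans (sym (cast-is-id refl _))
    (toList-injective refl (iterate rotate xs m) xs (begin
      toList (iterate rotate xs m)
        ≡⟨ toList-iterate xs m ⟩
      iterate rotateList (toList xs) m
        ≡⟨ cong (iterate rotateList (toList xs)) (sym (length-toList xs)) ⟩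
      iterate rotateList (toList xs) (List.length (toList xs))
        ≡⟨ cong (λ ys → iterate rotateList ys (List.length (toList xs)))
                (sym (++-identityʳ (toList xs))) ⟩
      iterate rotateList (toList xs ++ []) (List.length (toList xs))
        ≡⟨ rotateList-++ (toList xs) [] ⟩
      toList xs ∎))
    where open ≡-Reasoning

~-trans : {xs ys zs : Vec A m} → xs ~ ys → ys ~ zs → xs ~ zs
~-trans (zero  , refl) q = q
~-trans (suc j , p)    q with ~-trans (j , p) q
... | i , r = suc i , r

private
  rotate-~ : (xs : Vec A m) → rotate xs ~ xs
  rotate-~ []                     = 0 , refl
  rotate-~ {m = suc p} xs@(_ ∷ _) = p , rotate-full xs

~-sym : {xs ys : Vec A m} → xs ~ ys → ys ~ xs
~-sym           (zero  , refl) = 0 , refl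
~-sym {xs = xs} (suc j , p)    = ~-trans (~-sym (j , p)) (rotate-~ xs)

rotationSetoid : Set → ℕ → Setoid 0ℓ 0ℓ
rotationSetoid A m = record
  { Carrier       = Vec A m
  ; _≈_           = _~_
  ; isEquivalence = record { refl = 0 , refl ; sym = ~-sym ; trans = ~-trans }
  }

Cycles : ℕ → Vec ℕ n → Setoid 0ℓ 0ℓ
Cycles {n} m π =
  On.setoid {B = Σ[ is ∈ Vec (Fin n) m ] IsCycle π is} (rotationSetoid (Fin n) m) proj₁

-- Equality compares only the sequences, not the attached proofs and bijections.
ParkingFunctionsWithCycles : (n m k : ℕ) → Setoid 0ℓ 0ℓ
ParkingFunctionsWithCycles n m k =
  On.setoid
    {B = Σ[ π ∈ Vec ℕ n ] (IsParkingFunction π × HasCardinality (Cycles m π) k)}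
    (≡.setoid (Vec ℕ n)) proj₁

infixr 8 _^ℤ_

_^ℤ_ : (b : ℕ) → .{{NonZero b}} → ℤ → ℚ
b ^ℤ (+ j)    = + (b ^ j) / 1
b ^ℤ -[1+ j ] = (+ 1 / b ^ suc j) {{m^n≢0 b (suc j)}}

-- The multinomial coefficient "N choose ms"; meaningful when N is the sum of ms.
multinomial : ℕ → List ℕ → ℚ
multinomial N ms = (+ (N !) / product (List.map _! ms))
  {{product≢0 (All-map⁺ (ListAll.universal _!≢0 ms))}}

-- The exponent is subtracted in ℤ because it equals −1 when (k + ℓ) m = n.
summand : (n m k ℓ : ℕ) → ℚ
summand n m k ℓ =
  ((-1ℤ ℤ.^ ℓ ℤ.* + (((m ∸ 1) !) ^ (k + ℓ))) / (k ! * ℓ !)) {{k !* ℓ !≢0}}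
  ℚ.* multinomial (suc n) (replicate (k + ℓ) m ++ [ n ∸ (k + ℓ) * m + 1 ])
  ℚ.* suc n ^ℤ (+ n ℤ.- + ((k + ℓ) * m) ℤ.- 1ℤ)

sumℚ : List ℚ → ℚ
sumℚ = foldr ℚ._+_ 0ℚ

{-# OPTIONS --safe #-}
-- Inclusion–exclusion over sets of disjoint m-cycles.  If c(π) is the number of m-cycles
-- of π, then m^j · c(π)(c(π)−1)⋯(c(π)−j+1) counts the tuples of j pairwise disjoint cycles
-- of π, each with a marked starting point.  Such a tuple is a word t of s = j m distinct
-- indices, and it prescribes the values of π at the indices in t to be those same indices,
-- rotated within each block.  Being a parking function depends only on the multiset of
-- values, so the number of pairs (π, t) is the number of pairs (t, g) with g a word of
-- length n − s such that t g is a parking function.  Pollak's circle argument, applied to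
-- words over ℤ/(n+1), shows that exactly one rotation of each t g is parking, whence
--
--   (n+1) ∑_π m^j c(π)(c(π)−1)⋯(c(π)−j+1) = (n+1)! / (n+1−s)! · (n+1)^(n−s).
--
-- Finally [c = k] = ∑_ℓ (−1)^ℓ C(c,k) C(c−k,ℓ) recovers the parking functions with exactly
-- k cycles, and C(c,k) C(c−k,ℓ) k! ℓ! is the falling factorial of c of length k + ℓ.
module Submission where

open import Defs
open import Data.Fin.Base as Fin using (Fin; zero; suc; toℕ; inject₁; fromℕ; fromℕ<; punchIn; punchOut)
open import Data.Fin.Induction using (<-weakInduction)
open import Data.Fin.Permutation using (↔⇒≡)
open import Data.Fin.Properties as Fin
  using (toℕ-inject₁; toℕ-fromℕ; toℕ-fromℕ<; toℕ<n; toℕ≤pred[n]; toℕ-injective;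
         inject₁-injective; fromℕ≢inject₁; punchIn-punchOut; injective⇒≤)
open import Data.Fin.Relation.Unary.Top using (view; ‵fromℕ; ‵inject₁)
open import Data.Integer.Base as ℤ using (ℤ; 0ℤ; 1ℤ; -1ℤ)
open import Data.Integer.Base using (+_)
import Data.Integer.Properties as ℤₚ
import Data.Integer.Tactic.RingSolver as ℤ-Solver
open import Data.List.Base as List
  using (List; []; _∷_; _++_; foldr; length; allFin; replicate; cartesianProductWith; deduplicate)
open import Data.List.Base using (map; filter; upTo)
open import Data.List.Membership.DecPropositional using () renaming (_∈?_ to mem?)
open import Data.List.Membership.Propositional using (_∈_; _∉_; find; lose)
open import Data.List.Membership.Propositional.Properties
  using (∈-allFin; ∈-cartesianProductWith⁺; ∈-lookup; ∈-map⁺; ∈-++⁺ˡ)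
import Data.List.Membership.Setoid.Properties as SetoidMembership
open import Data.List.Properties as Listₚ
  using (map-++; map-∘; map-cong; map-tabulate; length-++; length-tabulate; upTo-∷ʳ)
open import Data.List.Relation.Binary.Permutation.Propositional
  using (_↭_; ↭-refl; ↭-sym; ↭-trans; ↭-reflexive; prep; swap; ↭⇒↭ₛ; module PermutationReasoning)
open import Data.List.Relation.Binary.Permutation.Propositional.Properties as Permₚ
  using (↭-length; ∈-resp-↭)
import Data.List.Relation.Binary.Permutation.Setoid.Properties as SetoidPerm
open import Data.List.Relation.Unary.All as All using ([]; _∷_)
open import Data.List.Relation.Unary.AllPairs as AllPairs using (AllPairs; []; _∷_)
open import Data.List.Relation.Unary.Any as Any using (Any; here; there)
import Data.List.Relation.Unary.Any.Properties as Anyₚ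
import Data.List.Relation.Unary.Linked as ListLinked
open import Data.List.Relation.Unary.Unique.DecSetoid.Properties using (deduplicate-!)
open import Data.List.Relation.Unary.Unique.Propositional using (Unique)
import Data.List.Relation.Unary.Unique.Propositional.Properties as Uniq
open import Data.List.Sort.Base using (module SortingAlgorithm)
open import Data.List.Sort.MergeSort using (mergeSort)
open import Data.Nat.Base as ℕ hiding (_/_)
open import Data.Nat.Base using (ℕ; suc; _+_; _*_; _≤_)
open import Data.Nat.Combinatorics using (_C_; nCk+nC[k+1]≡[n+1]C[k+1]; k>n⇒nCk≡0; k![n∸k]!∣n!; nCn≡1)
open import Data.Nat.Combinatorics.Specification using (nCk≡n!/k![n-k]!)
open import Data.Nat.DivMod using (m/n*n≡m)
open import Data.Nat.GeneralisedArithmetic using (iterate)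
open import Data.Nat.ListAction using (sum; product)
open import Data.Nat.ListAction.Properties using (sum-++; sum-↭)
open import Data.Nat.Properties as ℕ
open import Data.Nat.Properties using (_≤?_)
open import Data.Nat.Tactic.RingSolver using (solve-∀)
open import Data.Product.Base using (∃-syntax; ∃₂; _,_; proj₁; proj₂)
open import Data.Product.Base using (Σ-syntax; _×_)
open import Data.Rational.Base as ℚ using (ℚ; toℚᵘ)
open import Data.Rational.Base using (_/_)
open import Data.Rational.Properties
  using (toℚᵘ-homo-*; toℚᵘ-homo-+; toℚᵘ-injective; toℚᵘ-fromℚᵘ; fromℚᵘ-cong)
open import Data.Rational.Unnormalised.Base as ℚᵘ using (mkℚᵘ; *≡*)
import Data.Rational.Unnormalised.Properties as ℚᵘₚ
open import Data.Vec.Base as Vec using (Vec; []; _∷_; _∷ʳ_; toList; lookup; head; insertAt)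
open import Data.Vec.Membership.Propositional.Properties using (∈-toList⁻)
open import Data.Vec.Properties as Vecₚ
  using (∷-injective; ∷-injectiveˡ; ∷-injectiveʳ; insertAt-lookup; insertAt-punchIn; length-toList;
         lookup-map; map-∷ʳ; toList-map; toList-++; toList-∷ʳ; toList∘fromList)
open import Data.Vec.Relation.Unary.All as VAll using (All; []; _∷_)
import Data.Vec.Relation.Unary.All.Properties as VAllₚ
open import Data.Vec.Relation.Unary.AllPairs as VPairs using ([]; _∷_)
import Data.Vec.Relation.Unary.AllPairs.Properties as VPairsₚ
import Data.Vec.Relation.Unary.Any as VAny
import Data.Vec.Relation.Unary.Any.Properties as VAnyₚ
open import Data.Vec.Relation.Unary.Linked as Linked using (Linked; []; [-]; _∷_)
open import Data.Vec.Relation.Unary.Linked.Properties using (Linked⇒All)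
import Data.Vec.Relation.Unary.Unique.Propositional as V
import Data.Vec.Relation.Unary.Unique.Propositional.Properties as Vₚ
import Function.Construct.Composition as Composition
import Function.Construct.Symmetry as Symmetry
open import Function.Base using (_∘_; id)
open import Level using (0ℓ)
open import Relation.Binary.Bundles using (Setoid; DecSetoid)
open import Relation.Binary.Definitions using (DecidableEquality)
open import Relation.Binary.PropositionalEquality using (_≡_)
open import Relation.Binary.PropositionalEquality
  using (_≢_; refl; sym; trans; cong; cong₂; subst; subst₂; setoid; module ≡-Reasoning)
open import Relation.Nullary.Decidable using (Dec; yes; no; _×-dec_; _→-dec_; ¬?; map′)
open import Relation.Nullary.Negation using (¬_; contradiction)
open import Relation.Unary using (Decidable)

-- Cycle indices take only n values, while rotating the circle needs all n + 1 letters. The word t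
-- may nevertheless range over n + 1 letters: the value n + 1 never occurs in a parking function, so
-- words t that use it contribute nothing. Once positions are forgotten, the only condition left on
-- t is that its letters are distinct, and rotation preserves this. Hence (n+1)! / (n+1-s)!, and the
-- n + 1 on top of the multinomial coefficient. Tuples of distinct cycles are automatically
-- disjoint, because two cycles of one function share either all of their indices or none.
--
-- In the formula, ((m-1)!)^(k+ℓ) against (m!)^(k+ℓ) leaves m^(-(k+ℓ)), which forgets the marked
-- starting points; k! and ℓ! forget the order within the two groups of chosen cycles. The exponent
-- is lowered by one because one word is kept from each rotation class of n + 1 words. As it can
-- reach -1, the counting identities stay in ℕ, multiplied through by n + 1, and division is
-- postponed to the comparison with the summand.

private
  variable
    A B D X P Q : Set
    n k l q : ℕ

-- Finite sums and indicators

∑ : List A → (A → ℕ) → ℕ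
∑ xs f = sum (map f xs)

syntax ∑ xs (λ x → e) = ∑[ x ← xs ] e
infixr 5 ∑

∑-cong : (xs : List A) {f g : A → ℕ} → (∀ x → f x ≡ g x) → ∑ xs f ≡ ∑ xs g
∑-cong xs eq = cong sum (map-cong eq xs)

∑-cong-∈ : (xs : List A) {f g : A → ℕ} → (∀ {x} → x ∈ xs → f x ≡ g x) → ∑ xs f ≡ ∑ xs g
∑-cong-∈ []       eq = refl
∑-cong-∈ (x ∷ xs) eq = cong₂ _+_ (eq (here refl)) (∑-cong-∈ xs (eq ∘ there))

∑-0 : (xs : List A) → ∑[ _ ← xs ] 0 ≡ 0
∑-0 []       = refl
∑-0 (_ ∷ xs) = ∑-0 xs

∑-1 : (xs : List A) → ∑[ _ ← xs ] 1 ≡ length xs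
∑-1 []       = refl
∑-1 (_ ∷ xs) = cong suc (∑-1 xs)

∑-+ : (xs : List A) (f g : A → ℕ) → ∑[ x ← xs ] (f x + g x) ≡ ∑ xs f + ∑ xs g
∑-+ []       f g = refl
∑-+ (x ∷ xs) f g rewrite ∑-+ xs f g = interchange (f x) (g x) (∑ xs f) (∑ xs g)
  where
  interchange : ∀ a b c d → (a + b) + (c + d) ≡ (a + c) + (b + d)
  interchange = solve-∀

∑-*ˡ : (xs : List A) (a : ℕ) (f : A → ℕ) → ∑[ x ← xs ] (a * f x) ≡ a * ∑ xs f
∑-*ˡ []       a f = sym (*-zeroʳ a)
∑-*ˡ (x ∷ xs) a f rewrite ∑-*ˡ xs a f = sym (*-distribˡ-+ a (f x) (∑ xs f))

∑-*ʳ : (xs : List A) (a : ℕ) (f : A → ℕ) → ∑[ x ← xs ] (f x * a) ≡ ∑ xs f * a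
∑-*ʳ xs a f = trans (∑-cong xs λ x → *-comm (f x) a) (trans (∑-*ˡ xs a f) (*-comm a _))

∑-const : (xs : List A) (a : ℕ) → ∑[ _ ← xs ] a ≡ length xs * a
∑-const xs a = trans (∑-cong xs λ _ → sym (*-identityˡ a))
  (trans (∑-*ʳ xs a (λ _ → 1)) (cong (_* a) (∑-1 xs)))

∑-swap : (xs : List A) (ys : List B) (f : A → B → ℕ) →
  ∑[ x ← xs ] ∑[ y ← ys ] f x y ≡ ∑[ y ← ys ] ∑[ x ← xs ] f x y
∑-swap []       ys f = sym (∑-0 ys)
∑-swap (x ∷ xs) ys f = trans (cong (λ y → ∑ ys (f x) + y) (∑-swap xs ys f)) (sym (∑-+ ys (f x) _))

∑-++ : (xs ys : List A) (f : A → ℕ) → ∑ (xs ++ ys) f ≡ ∑ xs f + ∑ ys f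
∑-++ xs ys f = trans (cong sum (map-++ f xs ys)) (sum-++ (map f xs) (map f ys))

∑-map : (g : A → B) (xs : List A) (f : B → ℕ) → ∑ (map g xs) f ≡ ∑ xs (f ∘ g)
∑-map g xs f = cong sum (sym (map-∘ xs))

∑-cartesianProductWith : (g : A → B → D) (xs : List A) (ys : List B) (f : D → ℕ) →
  ∑ (cartesianProductWith g xs ys) f ≡ ∑[ x ← xs ] ∑[ y ← ys ] f (g x y)
∑-cartesianProductWith g []       ys f = refl
∑-cartesianProductWith g (x ∷ xs) ys f = trans (∑-++ (map (g x) ys) _ f)
  (cong₂ _+_ (∑-map (g x) ys f) (∑-cartesianProductWith g xs ys f))

∑-allFin-suc : (f : Fin (suc n) → ℕ) → ∑ (allFin (suc n)) f ≡ f zero + ∑ (allFin n) (f ∘ suc)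
∑-allFin-suc f = cong (λ y → f zero + y) (cong sum (trans (map-tabulate suc f) (sym (map-tabulate id (f ∘ suc)))))

-- Peeling off the top letter instead of `zero`. Set against `∑-allFin-suc`, it shows that sums are
-- unchanged by `cyclicPred`; alone, it removes the letter that is not an index.
∑-allFin-inject₁ : (f : Fin (suc n) → ℕ) →
  ∑ (allFin (suc n)) f ≡ f (fromℕ n) + ∑ (allFin n) (f ∘ inject₁)
∑-allFin-inject₁ {zero}  f = refl
∑-allFin-inject₁ {suc n} f = begin
  ∑ (allFin (suc (suc n))) f                                     ≡⟨ ∑-allFin-suc f ⟩
  f zero + ∑ (allFin (suc n)) (f ∘ suc)                          ≡⟨ cong (λ y → f zero + y) (∑-allFin-inject₁ (f ∘ suc)) ⟩
  f zero + (f (fromℕ (suc n)) + ∑ (allFin n) (f ∘ suc ∘ inject₁)) ≡⟨ exchange (f zero) (f (fromℕ (suc n))) _ ⟩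
  f (fromℕ (suc n)) + (f zero + ∑ (allFin n) (f ∘ suc ∘ inject₁)) ≡⟨ cong (λ y → f (fromℕ (suc n)) + y) (∑-allFin-suc (f ∘ inject₁)) ⟨
  f (fromℕ (suc n)) + ∑ (allFin (suc n)) (f ∘ inject₁)           ∎
  where
  open ≡-Reasoning
  exchange : ∀ a b c → a + (b + c) ≡ b + (a + c)
  exchange = solve-∀

𝟙 : Dec P → ℕ
𝟙 (yes _) = 1
𝟙 (no _)  = 0

𝟙-yes : (d : Dec P) → P → 𝟙 d ≡ 1
𝟙-yes (yes _) p = refl
𝟙-yes (no ¬p) p = contradiction p ¬p

𝟙-no : (d : Dec P) → ¬ P → 𝟙 d ≡ 0
𝟙-no (yes p) ¬p = contradiction p ¬p
𝟙-no (no _)  ¬p = refl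

𝟙-cong : (d : Dec P) (e : Dec Q) → (P → Q) → (Q → P) → 𝟙 d ≡ 𝟙 e
𝟙-cong (yes p) e f g = sym (𝟙-yes e (f p))
𝟙-cong (no ¬p) e f g = sym (𝟙-no e (¬p ∘ g))

𝟙-× : (d : Dec P) (e : Dec Q) → 𝟙 (d ×-dec e) ≡ 𝟙 d * 𝟙 e
𝟙-× (yes _) (yes _) = refl
𝟙-× (yes _) (no _)  = refl
𝟙-× (no _)  _       = refl

𝟙-¬ : (d : Dec P) → 𝟙 d + 𝟙 (¬? d) ≡ 1
𝟙-¬ (yes _) = refl
𝟙-¬ (no _)  = refl

-- Conditional facts enter unrestricted sums this way: where the condition fails, both sides are 0.
𝟙-*-cong : (d : Dec P) {a b : ℕ} → (P → a ≡ b) → 𝟙 d * a ≡ 𝟙 d * b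
𝟙-*-cong (yes p) eq = cong (1 *_) (eq p)
𝟙-*-cong (no _)  eq = refl

∑-filter : {P : A → Set} (P? : Decidable P) (xs : List A) (f : A → ℕ) →
  ∑ (filter P? xs) f ≡ ∑[ x ← xs ] (𝟙 (P? x) * f x)
∑-filter P? []       f = refl
∑-filter P? (x ∷ xs) f with P? x
... | yes _ = cong₂ _+_ (sym (*-identityˡ (f x))) (∑-filter P? xs f)
... | no _  = ∑-filter P? xs f

∑-none : {P : A → Set} (P? : Decidable P) (xs : List A) → (∀ {x} → x ∈ xs → ¬ P x) →
  ∑[ x ← xs ] 𝟙 (P? x) ≡ 0
∑-none P? xs none = trans (∑-cong-∈ xs λ x∈xs → 𝟙-no (P? _) (none x∈xs)) (∑-0 xs)

-- Mutual exclusion is assumed rather than equality with a witness, so that the lemma also serves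
-- lists of pairwise inequivalent representatives.
∑-one : {P : A → Set} (P? : Decidable P) {xs : List A} →
  AllPairs (λ x y → P x → ¬ P y) xs → Any P xs → ∑[ x ← xs ] 𝟙 (P? x) ≡ 1
∑-one P? {x ∷ xs} (excl ∷ _) (here px)
  rewrite 𝟙-yes (P? x) px = cong suc (∑-none P? xs λ y∈xs → All.lookup excl y∈xs px)
∑-one P? {x ∷ xs} (excl ∷ pairs) (there any)
  rewrite 𝟙-no (P? x) (λ px → let _ , y∈xs , py = find any in All.lookup excl y∈xs px py) =
  ∑-one P? pairs any

∑-unique : {P : A → Set} (P? : Decidable P) {xs : List A} → Unique xs →
  ∀ {x} → x ∈ xs → P x → (∀ {y} → P y → y ≡ x) → ∑[ y ← xs ] 𝟙 (P? y) ≡ 1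
∑-unique P? xs! x∈xs px only = ∑-one P?
  (AllPairs.map (λ y≢z py pz → y≢z (trans (only py) (sym (only pz)))) xs!)
  (lose x∈xs px)

-- Membership becomes a sum that can be exchanged with other sums; distinct entries keep it from
-- exceeding 1.
∑-∈ : (_≟A_ : DecidableEquality A) (xs : List A) → Unique xs → ∀ {x} (d : Dec (x ∈ xs)) →
  𝟙 d ≡ ∑[ y ← xs ] 𝟙 (x ≟A y)
∑-∈ _≟A_ xs xs! {x} (yes x∈xs) = sym (∑-unique (x ≟A_) xs! x∈xs refl sym)
∑-∈ _≟A_ xs xs! {x} (no x∉xs)  = sym (∑-none (x ≟A_) xs λ { y∈xs refl → x∉xs y∈xs })

-- Sums over words of a given length

vecs : List A → (n : ℕ) → List (Vec A n)
vecs xs zero    = [] ∷ []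
vecs xs (suc n) = cartesianProductWith _∷_ xs (vecs xs n)

∑-vecs-suc : (xs : List A) (f : Vec A (suc n) → ℕ) →
  ∑ (vecs xs (suc n)) f ≡ ∑[ x ← xs ] ∑[ v ← vecs xs n ] f (x ∷ v)
∑-vecs-suc {n = n} xs = ∑-cartesianProductWith _∷_ xs (vecs xs n)

∈-vecs : {xs : List A} → (∀ x → x ∈ xs) → (v : Vec A n) → v ∈ vecs xs n
∈-vecs all []      = here refl
∈-vecs all (x ∷ v) = ∈-cartesianProductWith⁺ _∷_ (all x) (∈-vecs all v)

vecs! : {xs : List A} → Unique xs → ∀ n → Unique (vecs xs n)
vecs! xs! zero    = [] ∷ []
vecs! xs! (suc n) = Uniq.cartesianProductWith⁺ _∷_ ∷-injective xs! (vecs! xs! n)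

length-vecs : (xs : List A) (n : ℕ) → length (vecs xs n) ≡ length xs ^ n
length-vecs xs zero    = refl
length-vecs xs (suc n) = begin
  length (vecs xs (suc n))            ≡⟨ ∑-1 (vecs xs (suc n)) ⟨
  ∑[ _ ← vecs xs (suc n) ] 1          ≡⟨ ∑-vecs-suc xs (λ _ → 1) ⟩
  ∑[ _ ← xs ] ∑[ _ ← vecs xs n ] 1    ≡⟨ ∑-cong xs (λ _ → ∑-1 (vecs xs n)) ⟩
  ∑[ _ ← xs ] length (vecs xs n)      ≡⟨ ∑-const xs _ ⟩
  length xs * length (vecs xs n)      ≡⟨ cong (length xs *_) (length-vecs xs n) ⟩
  length xs ^ suc n                   ∎
  where open ≡-Reasoning

∑-vecs-++ : (xs : List A) (s : ℕ) (f : Vec A (s + l) → ℕ) →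
  ∑ (vecs xs (s + l)) f ≡ ∑[ t ← vecs xs s ] ∑[ g ← vecs xs l ] f (t Vec.++ g)
∑-vecs-++ xs zero    f = sym (+-identityʳ _)
∑-vecs-++ {l = l} xs (suc s) f = begin
  ∑ (vecs xs (suc (s + l))) f  ≡⟨ ∑-vecs-suc xs f ⟩
  ∑[ x ← xs ] ∑[ v ← vecs xs (s + l) ] f (x ∷ v)  ≡⟨ ∑-cong xs (λ x → ∑-vecs-++ xs s (λ v → f (x ∷ v))) ⟩
  ∑[ x ← xs ] ∑[ t ← vecs xs s ] ∑[ g ← vecs xs l ] f (x ∷ t Vec.++ g)  ≡⟨ ∑-vecs-suc xs _ ⟨
  ∑[ t ← vecs xs (suc s) ] ∑[ g ← vecs xs l ] f (t Vec.++ g) ∎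
  where open ≡-Reasoning

∑-vecs-concat : (xs : List A) (m s : ℕ) (f : Vec A (s * m) → ℕ) →
  ∑[ t ← vecs (vecs xs m) s ] f (Vec.concat t) ≡ ∑ (vecs xs (s * m)) f
∑-vecs-concat xs m zero    f = refl
∑-vecs-concat xs m (suc s) f = begin
  ∑[ t ← vecs (vecs xs m) (suc s) ] f (Vec.concat t)  ≡⟨ ∑-vecs-suc (vecs xs m) _ ⟩
  ∑[ v ← vecs xs m ] ∑[ t ← vecs (vecs xs m) s ] f (v Vec.++ Vec.concat t)
    ≡⟨ ∑-cong (vecs xs m) (λ v → ∑-vecs-concat xs m s (λ u → f (v Vec.++ u))) ⟩
  ∑[ v ← vecs xs m ] ∑[ u ← vecs xs (s * m) ] f (v Vec.++ u)  ≡⟨ ∑-vecs-++ xs m f ⟨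
  ∑ (vecs xs (suc s * m)) f ∎
  where open ≡-Reasoning

-- Invariance is assumed for sums over letters instead of a bijection; it then passes to words one
-- letter at a time.
∑-vecs-reindex : (xs : List A) (φ : A → A) →
  (∀ (f : A → ℕ) → ∑ xs (f ∘ φ) ≡ ∑ xs f) →
  ∀ n (f : Vec A n → ℕ) → ∑ (vecs xs n) (f ∘ Vec.map φ) ≡ ∑ (vecs xs n) f
∑-vecs-reindex xs φ inv zero    f = refl
∑-vecs-reindex xs φ inv (suc n) f = begin
  ∑ (vecs xs (suc n)) (f ∘ Vec.map φ)                       ≡⟨ ∑-vecs-suc xs _ ⟩
  ∑[ x ← xs ] ∑[ v ← vecs xs n ] f (φ x ∷ Vec.map φ v)
    ≡⟨ ∑-cong xs (λ x → ∑-vecs-reindex xs φ inv n (λ v → f (φ x ∷ v))) ⟩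
  ∑[ x ← xs ] ∑[ v ← vecs xs n ] f (φ x ∷ v)                ≡⟨ inv (λ y → ∑[ v ← vecs xs n ] f (y ∷ v)) ⟩
  ∑[ x ← xs ] ∑[ v ← vecs xs n ] f (x ∷ v)                  ≡⟨ ∑-vecs-suc xs f ⟨
  ∑ (vecs xs (suc n)) f                                     ∎
  where open ≡-Reasoning

∑-vecs-insertAt : (xs : List A) (i : Fin (suc n)) (f : Vec A (suc n) → ℕ) →
  ∑ (vecs xs (suc n)) f ≡ ∑[ x ← xs ] ∑[ v ← vecs xs n ] f (insertAt v i x)
∑-vecs-insertAt xs zero f = ∑-vecs-suc xs f
∑-vecs-insertAt {n = suc n} xs (suc i) f = begin
  ∑ (vecs xs (suc (suc n))) f                               ≡⟨ ∑-vecs-suc xs f ⟩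
  ∑[ y ← xs ] ∑[ v ← vecs xs (suc n) ] f (y ∷ v)            ≡⟨ ∑-cong xs (λ y → ∑-vecs-insertAt xs i _) ⟩
  ∑[ y ← xs ] ∑[ x ← xs ] ∑[ v ← vecs xs n ] f (y ∷ insertAt v i x)  ≡⟨ ∑-swap xs xs _ ⟩
  ∑[ x ← xs ] ∑[ y ← xs ] ∑[ v ← vecs xs n ] f (y ∷ insertAt v i x)  ≡⟨ ∑-cong xs (λ x → ∑-vecs-suc xs (λ v → f (insertAt v (suc i) x))) ⟨
  ∑[ x ← xs ] ∑[ v ← vecs xs (suc n) ] f (insertAt v (suc i) x) ∎
  where open ≡-Reasoning

-- Words with prescribed letters

∑-pick : (_≟A_ : DecidableEquality A) (xs : List A) → Unique xs → ∀ {a} → a ∈ xs → (f : A → ℕ) →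
  ∑[ x ← xs ] (𝟙 (x ≟A a) * f x) ≡ f a
∑-pick _≟A_ xs xs! {a} a∈xs f = begin
  ∑[ x ← xs ] (𝟙 (x ≟A a) * f x)  ≡⟨ ∑-cong xs (λ x → 𝟙-*-cong (x ≟A a) (cong f)) ⟩
  ∑[ x ← xs ] (𝟙 (x ≟A a) * f a)  ≡⟨ ∑-*ʳ xs (f a) _ ⟩
  (∑[ x ← xs ] 𝟙 (x ≟A a)) * f a    ≡⟨ cong (_* f a) (∑-unique (_≟A a) xs! a∈xs refl id) ⟩
  1 * f a                         ≡⟨ *-identityˡ (f a) ⟩
  f a                             ∎
  where open ≡-Reasoning

toList-insertAt-↭ : (v : Vec A n) (i : Fin (suc n)) (x : A) → toList (insertAt v i x) ↭ x ∷ toList v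
toList-insertAt-↭ v       zero    x = ↭-refl
toList-insertAt-↭ (y ∷ v) (suc i) x = ↭-trans (prep y (toList-insertAt-↭ v i x)) (swap y x ↭-refl)

map-punchIn⁻ : {i : Fin (suc n)} {p : Vec (Fin (suc n)) k} → VAll.All (i ≢_) p →
  ∃[ q ] p ≡ Vec.map (punchIn i) q
map-punchIn⁻ []          = [] , refl
map-punchIn⁻ (i≢j ∷ i∉p) with map-punchIn⁻ i∉p
... | q , eq = punchOut i≢j ∷ q , cong₂ _∷_ (sym (punchIn-punchOut i≢j)) eq

V-unique-map⁻ : {f : A → B} {xs : Vec A n} → V.Unique (Vec.map f xs) → V.Unique xs
V-unique-map⁻ {xs = []}     []          = []
V-unique-map⁻ {f = f} {xs = x ∷ xs} (x∉ ∷ xs!) = all⁻ x∉ ∷ V-unique-map⁻ xs!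
  where
  all⁻ : ∀ {k} {ys : Vec _ k} → VAll.All (f x ≢_) (Vec.map f ys) → VAll.All (x ≢_) ys
  all⁻ {ys = []}    []       = []
  all⁻ {ys = _ ∷ _} (≢ ∷ as) = (≢ ∘ cong f) ∷ all⁻ as

module _ (_≟X_ : DecidableEquality X) (xs : List X) (xs! : Unique xs) (∈xs : ∀ x → x ∈ xs) where

  private
    _≟V_ : DecidableEquality (Vec X k)
    _≟V_ = Vecₚ.≡-dec _≟X_

  -- Removing position `i` fixes its letter, and since `F` ignores order that letter may be moved to
  -- the front; distinctness lets the remaining positions be renumbered in the shorter word. The
  -- right side depends on the prescribed letters only, not on where they stand.
  ∑-prescribed : (F : List X → ℕ) → (∀ {u v} → u ↭ v → F u ≡ F v) →
    (p : Vec (Fin n) k) → V.Unique p → (v : Vec X k) →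
    ∑[ w ← vecs xs n ] (F (toList w) * 𝟙 (Vec.map (lookup w) p ≟V v)) ≡
    ∑[ g ← vecs xs (n ∸ k) ] F (toList v ++ toList g)
  ∑-prescribed {n} F F-↭ [] _ [] = ∑-cong (vecs xs n) λ w → *-identityʳ (F (toList w))
  ∑-prescribed {suc n} {suc k} F F-↭ (i ∷ p) (i∉p ∷ p!) (a ∷ v) with map-punchIn⁻ i∉p
  ... | q , refl = begin
    ∑[ w ← vecs xs (suc n) ] (F (toList w) * 𝟙 (Vec.map (lookup w) (i ∷ p) ≟V (a ∷ v)))
      ≡⟨ ∑-vecs-insertAt xs i _ ⟩
    ∑[ x ← xs ] ∑[ w ← vecs xs n ] (F (toList (insertAt w i x)) *
      𝟙 (Vec.map (lookup (insertAt w i x)) (i ∷ p) ≟V (a ∷ v)))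
      ≡⟨ ∑-cong xs (λ x → trans (∑-cong (vecs xs n) (split x)) (∑-*ˡ (vecs xs n) (𝟙 (x ≟X a)) _)) ⟩
    ∑[ x ← xs ] (𝟙 (x ≟X a) * (∑[ w ← vecs xs n ] (F (x ∷ toList w) * 𝟙 (Vec.map (lookup w) q ≟V v))))
      ≡⟨ ∑-pick _≟X_ xs xs! (∈xs a) _ ⟩
    ∑[ w ← vecs xs n ] (F (a ∷ toList w) * 𝟙 (Vec.map (lookup w) q ≟V v))
      -- The fixed letter is absorbed into the weight, which still ignores order.
      ≡⟨ ∑-prescribed (F ∘ (a ∷_)) (F-↭ ∘ prep a) q (V-unique-map⁻ p!) v ⟩
    ∑[ g ← vecs xs (n ∸ k) ] F (a ∷ toList v ++ toList g) ∎
    where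
    open ≡-Reasoning
    lookup-eq : ∀ x (w : Vec X n) → Vec.map (lookup (insertAt w i x)) (i ∷ p) ≡ x ∷ Vec.map (lookup w) q
    lookup-eq x w = cong₂ _∷_ (insertAt-lookup w i x)
      (trans (sym (Vecₚ.map-∘ (lookup (insertAt w i x)) (punchIn i) q)) (Vecₚ.map-cong (insertAt-punchIn w i x) q))
    rearrange : ∀ c d e → c * (d * e) ≡ d * (c * e)
    rearrange = solve-∀
    split : ∀ x w → F (toList (insertAt w i x)) * 𝟙 (Vec.map (lookup (insertAt w i x)) (i ∷ p) ≟V (a ∷ v)) ≡
      𝟙 (x ≟X a) * (F (x ∷ toList w) * 𝟙 (Vec.map (lookup w) q ≟V v))
    split x w = begin
      F (toList (insertAt w i x)) * 𝟙 (Vec.map (lookup (insertAt w i x)) (i ∷ p) ≟V (a ∷ v))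
        ≡⟨ cong₂ _*_ (F-↭ (toList-insertAt-↭ w i x))
             (𝟙-cong _ ((x ≟X a) ×-dec (Vec.map (lookup w) q ≟V v))
               (λ eq → ∷-injective (trans (sym (lookup-eq x w)) eq))
               (λ (eq₁ , eq₂) → trans (lookup-eq x w) (cong₂ _∷_ eq₁ eq₂))) ⟩
      F (x ∷ toList w) * 𝟙 ((x ≟X a) ×-dec (Vec.map (lookup w) q ≟V v))
        ≡⟨ cong (F (x ∷ toList w) *_) (𝟙-× (x ≟X a) _) ⟩
      F (x ∷ toList w) * (𝟙 (x ≟X a) * 𝟙 (Vec.map (lookup w) q ≟V v))
        ≡⟨ rearrange (F (x ∷ toList w)) (𝟙 (x ≟X a)) _ ⟩
      𝟙 (x ≟X a) * (F (x ∷ toList w) * 𝟙 (Vec.map (lookup w) q ≟V v)) ∎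

-- Leftmost minima and the circle argument

-- Ties are broken to the left; this makes the place unique and so singles out one rotation of each
-- word.
LeftMin : (Fin (suc n) → ℕ) → Fin (suc n) → Set
LeftMin f s = (∀ p → f s ≤ f p) × (∀ p → f p ≤ f s → s Fin.≤ p)

abstract
  leftMin? : (f : Fin (suc n) → ℕ) (s : Fin (suc n)) → Dec (LeftMin f s)
  leftMin? f s = Fin.all? (λ p → f s ≤? f p) ×-dec Fin.all? (λ p → (f p ≤? f s) →-dec (s Fin.≤? p))

leftMin-unique : (f : Fin (suc n) → ℕ) {s t : Fin (suc n)} → LeftMin f s → LeftMin f t → s ≡ t
leftMin-unique f {s} {t} (s-min , s-left) (t-min , t-left) =
  Fin.≤-antisym (s-left t (t-min s)) (t-left s (s-min t))

leftMin-exists : (f : Fin (suc n) → ℕ) → ∃[ s ] LeftMin f s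
leftMin-exists {zero} f = zero , (λ { zero → ≤-refl }) , λ _ _ → z≤n
leftMin-exists {suc n} f with leftMin-exists (f ∘ suc)
... | s , s-min , s-left with f zero ≤? f (suc s)
... | yes f0≤fs = zero , (λ { zero → ≤-refl ; (suc p) → ≤-trans f0≤fs (s-min p) }) , λ _ _ → z≤n
... | no  f0≰fs = suc s ,
  (λ { zero → <⇒≤ (≰⇒> f0≰fs) ; (suc p) → s-min p }) ,
  (λ { zero f0≤fs → contradiction f0≤fs f0≰fs ; (suc p) fp≤fs → s≤s (s-left p fp≤fs) })

∑-leftMin : (f : Fin (suc n) → ℕ) → ∑[ s ← allFin (suc n) ] 𝟙 (leftMin? f s) ≡ 1
∑-leftMin {n} f with leftMin-exists f
... | s , min = ∑-unique (leftMin? f) (Uniq.allFin⁺ (suc n)) (∈-allFin s) min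
  (λ min′ → leftMin-unique f min′ min)

module _ (f f′ : Fin (suc n) → ℕ) (c : ℕ)
  (shift : ∀ p → f′ (inject₁ p) + c ≡ suc (f (suc p))) (wrap : f′ (fromℕ n) + c ≡ f zero) where

  private
    inject⇒suc : ∀ p q → f′ (inject₁ p) ≤ f′ (inject₁ q) → f (suc p) ≤ f (suc q)
    inject⇒suc p q le = s≤s⁻¹ (subst₂ _≤_ (shift p) (shift q) (+-monoˡ-≤ c le))
    suc⇒inject : ∀ p q → f (suc p) ≤ f (suc q) → f′ (inject₁ p) ≤ f′ (inject₁ q)
    suc⇒inject p q le = +-cancelʳ-≤ c _ _ (subst₂ _≤_ (sym (shift p)) (sym (shift q)) (s≤s le))
    inject⇒suc-≤ : ∀ {p q : Fin n} → inject₁ p Fin.≤ inject₁ q → suc p Fin.≤ suc q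
    inject⇒suc-≤ {p} {q} le = s≤s (subst₂ _≤_ (toℕ-inject₁ p) (toℕ-inject₁ q) le)
    suc⇒inject-≤ : ∀ {p q : Fin n} → suc p Fin.≤ suc q → inject₁ p Fin.≤ inject₁ q
    suc⇒inject-≤ {p} {q} le = subst₂ _≤_ (sym (toℕ-inject₁ p)) (sym (toℕ-inject₁ q)) (s≤s⁻¹ le)

  -- Up to a constant, `f′` is `f` read from one place further on, with the old value at `zero`
  -- reappearing at the far end lowered by 1. A leftmost minimum at `suc s` beats place `zero`
  -- strictly; after the move that place lies to the right, and lowering it by 1 turns the strict
  -- inequality into the weak one needed there.
  leftMin-shift⁺ : ∀ s → LeftMin f (suc s) → LeftMin f′ (inject₁ s)
  leftMin-shift⁺ s (s-min , s-left) = min , left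
    where
    fs<f0 : f (suc s) < f zero
    fs<f0 = ≰⇒> λ f0≤fs → contradiction (s-left zero f0≤fs) λ ()
    min : ∀ p → f′ (inject₁ s) ≤ f′ p
    min p with view p
    ... | ‵fromℕ     = +-cancelʳ-≤ c _ _ (subst₂ _≤_ (sym (shift s)) (sym wrap) fs<f0)
    ... | ‵inject₁ q = suc⇒inject s q (s-min (suc q))
    left : ∀ p → f′ p ≤ f′ (inject₁ s) → inject₁ s Fin.≤ p
    left p le with view p
    ... | ‵fromℕ     = subst (toℕ (inject₁ s) ≤_) (sym (toℕ-fromℕ n)) (toℕ≤pred[n] (inject₁ s))
    ... | ‵inject₁ q = suc⇒inject-≤ (s-left (suc q) (inject⇒suc q s le))

  leftMin-shift⁻ : ∀ s → LeftMin f′ (inject₁ s) → LeftMin f (suc s)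
  leftMin-shift⁻ s (s-min , s-left) = min , left
    where
    fs<f0 : f (suc s) < f zero
    fs<f0 = subst₂ _≤_ (shift s) wrap (+-monoˡ-≤ c (s-min (fromℕ n)))
    min : ∀ p → f (suc s) ≤ f p
    min zero    = <⇒≤ fs<f0
    min (suc p) = inject⇒suc s p (s-min (inject₁ p))
    left : ∀ p → f p ≤ f (suc s) → suc s Fin.≤ p
    left zero    le = contradiction le (<⇒≱ fs<f0)
    left (suc p) le = inject⇒suc-≤ (s-left (inject₁ p) (suc⇒inject p s le))

-- Letter counts and the rotation of the circle

#[_<_] : List (Fin n) → ℕ → ℕ
#[ l < q ] = ∑[ x ← l ] 𝟙 (toℕ x <? q)

#<0 : (l : List (Fin n)) → #[ l < 0 ] ≡ 0
#<0 l = ∑-0 l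

#<n : (l : List (Fin n)) → #[ l < n ] ≡ length l
#<n l = trans (∑-cong l λ x → 𝟙-yes (toℕ x <? _) (toℕ<n x)) (∑-1 l)

cyclicPred : Fin (suc n) → Fin (suc n)
cyclicPred {n} zero    = fromℕ n
cyclicPred     (suc x) = inject₁ x

∑-cyclicPred : (f : Fin (suc n) → ℕ) → ∑ (allFin (suc n)) (f ∘ cyclicPred) ≡ ∑ (allFin (suc n)) f
∑-cyclicPred f = trans (∑-allFin-suc (f ∘ cyclicPred)) (sym (∑-allFin-inject₁ f))

-- The letters `zero` wrap to the top and leave the range below `q`, so their number `#[ l < 1 ]` is
-- added back. The bound `q ≤ n` keeps the top letter out of that range.
#<-cyclicPred : (l : List (Fin (suc n))) {q : ℕ} → q ≤ n →
  #[ map cyclicPred l < q ] + #[ l < 1 ] ≡ #[ l < suc q ]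
#<-cyclicPred {n} l {q} q≤n = begin
  #[ map cyclicPred l < q ] + #[ l < 1 ]
    ≡⟨ cong (_+ #[ l < 1 ]) (∑-map cyclicPred l _) ⟩
  (∑[ x ← l ] 𝟙 (toℕ (cyclicPred x) <? q)) + #[ l < 1 ]
    ≡⟨ ∑-+ l _ _ ⟨
  ∑[ x ← l ] (𝟙 (toℕ (cyclicPred x) <? q) + 𝟙 (toℕ x <? 1))
    ≡⟨ ∑-cong l pointwise ⟩
  #[ l < suc q ] ∎
  where
  open ≡-Reasoning
  pointwise : ∀ x → 𝟙 (toℕ (cyclicPred x) <? q) + 𝟙 (toℕ x <? 1) ≡ 𝟙 (toℕ x <? suc q)
  pointwise zero = trans
    (cong (_+ 1) (𝟙-no (toℕ (fromℕ n) <? q) (λ lt → <⇒≱ lt (subst (q ≤_) (sym (toℕ-fromℕ n)) q≤n))))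
    (sym (𝟙-yes (0 <? suc q) z<s))
  pointwise (suc x) = trans
    (cong (λ y → 𝟙 (toℕ (inject₁ x) <? q) + y) (𝟙-no (suc (toℕ x) <? 1) λ { (s≤s ()) }))
    (trans (+-identityʳ _) (𝟙-cong _ _
      (λ lt → s≤s (subst (_< q) (toℕ-inject₁ x) lt))
      (λ lt → subst (_< q) (sym (toℕ-inject₁ x)) (s≤s⁻¹ lt))))

-- The walk p ↦ #[ l < p ] − p, raised by n to stay in ℕ; since p ≤ n, nothing is truncated.
height : List (Fin (suc n)) → Fin (suc n) → ℕ
height {n} l p = #[ l < toℕ p ] + (n ∸ toℕ p)

-- The walk gains the number of letters at each place and loses 1 per place, so `n` letters on
-- `n + 1` places give a net drop of 1 per turn. This is where `length l ≡ n` enters, and why `wrap`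
-- lacks the `suc` of `shift`.
leftMin-cyclicPred : (l : List (Fin (suc n))) → length l ≡ n → (s : Fin n) →
  𝟙 (leftMin? (height l) (suc s)) ≡ 𝟙 (leftMin? (height (map cyclicPred l)) (inject₁ s))
leftMin-cyclicPred {n} l len s = 𝟙-cong _ _
  (leftMin-shift⁺ (height l) (height l′) #[ l < 1 ] shift wrap s)
  (leftMin-shift⁻ (height l) (height l′) #[ l < 1 ] shift wrap s)
  where
  open ≡-Reasoning
  l′ = map cyclicPred l
  exchange : ∀ a b c → a + suc b + c ≡ suc (a + c + b)
  exchange = solve-∀
  shift : ∀ p → height l′ (inject₁ p) + #[ l < 1 ] ≡ suc (height l (suc p))
  shift p = begin
    #[ l′ < toℕ (inject₁ p) ] + (n ∸ toℕ (inject₁ p)) + #[ l < 1 ]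
      ≡⟨ cong (λ q → #[ l′ < q ] + (n ∸ q) + #[ l < 1 ]) (toℕ-inject₁ p) ⟩
    #[ l′ < toℕ p ] + (n ∸ toℕ p) + #[ l < 1 ]
      ≡⟨ cong (λ d → #[ l′ < toℕ p ] + d + #[ l < 1 ]) (+-∸-assoc 1 (toℕ<n p)) ⟩
    #[ l′ < toℕ p ] + suc (n ∸ suc (toℕ p)) + #[ l < 1 ]
      ≡⟨ exchange #[ l′ < toℕ p ] (n ∸ suc (toℕ p)) #[ l < 1 ] ⟩
    suc (#[ l′ < toℕ p ] + #[ l < 1 ] + (n ∸ suc (toℕ p)))
      ≡⟨ cong (λ c → suc (c + (n ∸ suc (toℕ p)))) (#<-cyclicPred l (<⇒≤ (toℕ<n p))) ⟩
    suc (height l (suc p)) ∎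
  wrap : height l′ (fromℕ n) + #[ l < 1 ] ≡ height l zero
  wrap = begin
    #[ l′ < toℕ (fromℕ n) ] + (n ∸ toℕ (fromℕ n)) + #[ l < 1 ]
      ≡⟨ cong (λ q → #[ l′ < q ] + (n ∸ q) + #[ l < 1 ]) (toℕ-fromℕ n) ⟩
    #[ l′ < n ] + (n ∸ n) + #[ l < 1 ]
      ≡⟨ cong (λ d → #[ l′ < n ] + d + #[ l < 1 ]) (n∸n≡0 n) ⟩
    #[ l′ < n ] + 0 + #[ l < 1 ]
      ≡⟨ cong (_+ #[ l < 1 ]) (+-identityʳ #[ l′ < n ]) ⟩
    #[ l′ < n ] + #[ l < 1 ]  ≡⟨ #<-cyclicPred l ≤-refl ⟩
    #[ l < suc n ]            ≡⟨ #<n l ⟩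
    length l                  ≡⟨ len ⟩
    n                         ≡⟨ cong (_+ n) (#<0 l) ⟨
    height l zero             ∎

leftMin-↭ : {k l : List (Fin (suc n))} (s : Fin (suc n)) → k ↭ l →
  𝟙 (leftMin? (height k) s) ≡ 𝟙 (leftMin? (height l) s)
leftMin-↭ {n} {k} {l} s k↭l = 𝟙-cong _ _ (transport eq) (transport (sym ∘ eq))
  where
  eq : ∀ p → height k p ≡ height l p
  eq p = cong (_+ (n ∸ toℕ p)) (sum-↭ (Permₚ.map⁺ _ k↭l))
  transport : ∀ {f g : Fin (suc n) → ℕ} → (∀ p → f p ≡ g p) → LeftMin f s → LeftMin g s
  transport eq (s-min , s-left) =
    (λ p → subst₂ _≤_ (eq s) (eq p) (s-min p)) ,
    (λ p le → s-left p (subst₂ _≤_ (sym (eq p)) (sym (eq s)) le))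

-- Pollak's circle argument: each rotation class of words over ℤ/(n+1) contains exactly
-- one word whose leftmost minimum is at 0, and U does not see the rotation.
∑-pollak : (n s : ℕ) → s ≤ n → (U : Vec (Fin (suc n)) s → ℕ) →
  (∀ t → U (Vec.map cyclicPred t) ≡ U t) →
  suc n * (∑[ t ← vecs (allFin (suc n)) s ] ∑[ g ← vecs (allFin (suc n)) (n ∸ s) ]
    (U t * 𝟙 (leftMin? (height (toList t ++ toList g)) zero))) ≡
  ∑ (vecs (allFin (suc n)) s) U * suc n ^ (n ∸ s)
∑-pollak n s s≤n U U-inv = begin
  suc n * W zero
    ≡⟨ cong (_* W zero) (length-tabulate {n = suc n} id) ⟨
  length N * W zero
    ≡⟨ ∑-const N (W zero) ⟨
  ∑[ _ ← N ] W zero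
    -- Rotating all letters carries the words counted by `W (suc i)` to those counted by
    -- `W (inject₁ i)`, so all `n + 1` places of the minimum carry the same total.
    ≡⟨ ∑-cong N (λ i → sym (<-weakInduction (λ i → W i ≡ W zero) refl (λ i eq → trans (step i) eq) i)) ⟩
  ∑[ i ← N ] W i
    ≡⟨ ∑-swap N (vecs N s) _ ⟩
  ∑[ t ← vecs N s ] ∑[ i ← N ] ∑[ g ← vecs N r ] w i t g
    ≡⟨ ∑-cong (vecs N s) (λ t → ∑-swap N (vecs N r) _) ⟩
  ∑[ t ← vecs N s ] ∑[ g ← vecs N r ] ∑[ i ← N ] w i t g
    ≡⟨ ∑-cong (vecs N s) (λ t → ∑-cong (vecs N r) (λ g →
         trans (∑-*ˡ N (U t) _) (trans (cong (U t *_) (∑-leftMin (height (toList t ++ toList g)))) (*-comm (U t) 1)))) ⟩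
  ∑[ t ← vecs N s ] ∑[ g ← vecs N r ] (1 * U t)
    ≡⟨ ∑-cong (vecs N s) (λ t → trans (∑-const (vecs N r) (1 * U t)) (cong₂ _*_
         (trans (length-vecs N r) (cong (_^ r) (length-tabulate {n = suc n} id))) (*-identityˡ (U t)))) ⟩
  ∑[ t ← vecs N s ] (suc n ^ r * U t)
    ≡⟨ ∑-*ˡ (vecs N s) (suc n ^ r) U ⟩
  suc n ^ r * ∑ (vecs N s) U
    ≡⟨ *-comm (suc n ^ r) _ ⟩
  ∑ (vecs N s) U * suc n ^ r ∎
  where
  open ≡-Reasoning
  N = allFin (suc n)
  r = n ∸ s
  w : Fin (suc n) → Vec (Fin (suc n)) s → Vec (Fin (suc n)) r → ℕ
  w i t g = U t * 𝟙 (leftMin? (height (toList t ++ toList g)) i)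
  W : Fin (suc n) → ℕ
  W i = ∑[ t ← vecs N s ] ∑[ g ← vecs N r ] w i t g
  len : (t : Vec (Fin (suc n)) s) (g : Vec (Fin (suc n)) r) → length (toList t ++ toList g) ≡ n
  len t g = begin
    length (toList t ++ toList g)            ≡⟨ length-++ (toList t) ⟩
    length (toList t) + length (toList g)    ≡⟨ cong₂ _+_ (length-toList t) (length-toList g) ⟩
    s + (n ∸ s)                              ≡⟨ m+[n∸m]≡n s≤n ⟩
    n                                        ∎
  rotated : ∀ i t g → w (suc i) t g ≡ w (inject₁ i) (Vec.map cyclicPred t) (Vec.map cyclicPred g)
  rotated i t g = cong₂ _*_ (sym (U-inv t)) (begin
    𝟙 (leftMin? (height (toList t ++ toList g)) (suc i))
      ≡⟨ leftMin-cyclicPred (toList t ++ toList g) (len t g) i ⟩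
    𝟙 (leftMin? (height (map cyclicPred (toList t ++ toList g))) (inject₁ i))
      ≡⟨ cong (λ l → 𝟙 (leftMin? (height l) (inject₁ i))) (trans (map-++ cyclicPred (toList t) (toList g))
           (sym (cong₂ _++_ (toList-map cyclicPred t) (toList-map cyclicPred g)))) ⟩
    𝟙 (leftMin? (height (toList (Vec.map cyclicPred t) ++ toList (Vec.map cyclicPred g))) (inject₁ i)) ∎)
  step : ∀ i → W (suc i) ≡ W (inject₁ i)
  step i = begin
    W (suc i)
      ≡⟨ ∑-cong (vecs N s) (λ t → ∑-cong (vecs N r) (rotated i t)) ⟩
    ∑[ t ← vecs N s ] ∑[ g ← vecs N r ] w (inject₁ i) (Vec.map cyclicPred t) (Vec.map cyclicPred g)
      ≡⟨ ∑-cong (vecs N s) (λ t → ∑-vecs-reindex N cyclicPred ∑-cyclicPred r (w (inject₁ i) (Vec.map cyclicPred t))) ⟩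
    ∑[ t ← vecs N s ] ∑[ g ← vecs N r ] w (inject₁ i) (Vec.map cyclicPred t) g
      ≡⟨ ∑-vecs-reindex N cyclicPred ∑-cyclicPred s (λ t → ∑[ g ← vecs N r ] w (inject₁ i) t g) ⟩
    W (inject₁ i) ∎

-- Parking functions as words

#[_≤_] : List ℕ → ℕ → ℕ
#[ l ≤ b ] = ∑[ x ← l ] 𝟙 (x ≤? b)

-- In a sorted word the entries at most `b` form an initial segment, and the count is its length.
sorted-lookup : {xs : Vec ℕ n} → Linked _≤_ xs → ∀ i b →
  (lookup xs i ≤ b → toℕ i < #[ toList xs ≤ b ]) × (toℕ i < #[ toList xs ≤ b ] → lookup xs i ≤ b)
sorted-lookup {xs = x ∷ xs} xs↗ i b with x ≤? b
sorted-lookup {xs = x ∷ xs} xs↗ zero    b | yes x≤b = (λ _ → z<s) , (λ _ → x≤b)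
sorted-lookup {xs = x ∷ xs} xs↗ (suc i) b | yes x≤b with sorted-lookup (Linked.tail xs↗) i b
... | to , from = s≤s ∘ to , from ∘ s≤s⁻¹
sorted-lookup {xs = x ∷ xs} xs↗ i b | no x≰b =
  (λ le → contradiction (≤-trans (VAllₚ.lookup⁺ x≤ i) le) x≰b) ,
  (λ lt → contradiction (subst (toℕ i <_) (none (VAll.tail x≤)) lt) λ ())
  where
  x≤ : All (x ≤_) (x ∷ xs)
  x≤ = Linked⇒All ≤-trans ≤-refl xs↗
  none : ∀ {k} {ys : Vec ℕ k} → All (x ≤_) ys → #[ toList ys ≤ b ] ≡ 0
  none []                      = refl
  none {ys = y ∷ _} (x≤y ∷ as) = cong₂ _+_ (𝟙-no (y ≤? b) (x≰b ∘ ≤-trans x≤y)) (none as)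

-- `IsParkingFunction` bounds every sorted rearrangement; to draw a conclusion from it, one has to
-- be exhibited.
sorted-rearrangement : (π : Vec ℕ n) → ∃[ λs ] (toList λs ↭ toList π) × Linked _≤_ λs
sorted-rearrangement {n} π = helper (sort (toList π)) (sort-↭ (toList π)) (sort-↗ (toList π))
  (trans (↭-length (sort-↭ (toList π))) (length-toList π))
  where
  open SortingAlgorithm (mergeSort ≤-decTotalOrder)
  linked : {ys : List ℕ} → ListLinked.Linked _≤_ ys → Linked _≤_ (Vec.fromList ys)
  linked ListLinked.[]       = []
  linked ListLinked.[-]      = [-]
  linked (r ListLinked.∷ rs) = r ∷ linked rs
  helper : (ys : List ℕ) → ys ↭ toList π → ListLinked.Linked _≤_ ys → length ys ≡ n →
    Σ[ λs ∈ Vec ℕ n ] (toList λs ↭ toList π) × Linked _≤_ λs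
  helper ys p s refl = Vec.fromList ys , ↭-trans (↭-reflexive (toList∘fromList ys)) p , linked s

#≤-↭ : {k l : List ℕ} (b : ℕ) → k ↭ l → #[ k ≤ b ] ≡ #[ l ≤ b ]
#≤-↭ b k↭l = sum-↭ (Permₚ.map⁺ _ k↭l)

-- The sorting-free criterion: at least q entries are at most q, for q = 1, ..., n. Being a count,
-- it sees only the multiset of values.
parking⇒# : {π : Vec ℕ n} → IsParkingFunction π → ∀ i → toℕ i < #[ toList π ≤ suc (toℕ i) ]
parking⇒# {π = π} (_ , bound) i with sorted-rearrangement π
... | λs , p , λs↗ = subst (toℕ i <_) (#≤-↭ _ p)
  (proj₁ (sorted-lookup λs↗ i (suc (toℕ i))) (bound λs p λs↗ i))

#⇒parking : {π : Vec ℕ n} → All (1 ≤_) π → (∀ i → toℕ i < #[ toList π ≤ suc (toℕ i) ]) →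
  IsParkingFunction π
#⇒parking pos # = pos , λ λs p λs↗ i →
  proj₂ (sorted-lookup λs↗ i (suc (toℕ i)))
    (subst (toℕ i <_) (sym (#≤-↭ _ p)) (# i))

-- A count that reaches the length leaves no room for a failure. Applied to the criterion at the
-- last place, this excludes the value n + 1.
∑-full : {P : A → Set} (P? : ∀ x → Dec (P x)) (xs : List A) →
  length xs ≤ ∑[ x ← xs ] 𝟙 (P? x) → All.All P xs
∑-full P? []       _  = []
∑-full P? (x ∷ xs) le with P? x
... | yes px = px ∷ ∑-full P? xs (s≤s⁻¹ le)
... | no  _  = contradiction le (<⇒≱ (s≤s (bound xs)))
  where
  bound : ∀ xs → ∑[ x ← xs ] 𝟙 (P? x) ≤ length xs
  bound []       = z≤n
  bound (x ∷ xs) with P? x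
  ... | yes _ = s≤s (bound xs)
  ... | no  _ = m≤n⇒m≤1+n (bound xs)

-- The letter x : Fin (suc n) stands for the value suc (toℕ x); the top letter n + 1
-- never occurs in a parking function but closes the circle.
values : Vec (Fin (suc n)) k → Vec ℕ k
values = Vec.map (suc ∘ toℕ)

values-surjective : (π : Vec ℕ k) → All (1 ≤_) π → All.All (_≤ suc n) (toList π) →
  ∃[ w ] values {n} w ≡ π
values-surjective []          []           []          = [] , refl
values-surjective (suc a ∷ π) (s≤s _ ∷ pos) (a<N ∷ top) with values-surjective π pos top
... | w , refl = fromℕ< a<N ∷ w , cong (λ b → suc b ∷ values w) (toℕ-fromℕ< a<N)

parking-word : 1 ≤ n → {π : Vec ℕ n} → IsParkingFunction π → ∃[ w ] values {n} w ≡ π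
parking-word {suc n} _ {π} park = values-surjective π (proj₁ park)
  (All.map m≤n⇒m≤1+n (∑-full (_≤? suc n) (toList π)
    (subst₂ (λ a b → a ≤ #[ toList π ≤ b ]) (trans (cong suc (toℕ-fromℕ n)) (sym (length-toList π)))
      (cong suc (toℕ-fromℕ n)) (parking⇒# park (fromℕ n)))))

#≤-values : (w : Vec (Fin (suc n)) k) (q : ℕ) → #[ toList (values w) ≤ q ] ≡ #[ toList w < q ]
#≤-values w q = begin
  #[ toList (values w) ≤ q ]             ≡⟨ cong #[_≤ q ] (toList-map (suc ∘ toℕ) w) ⟩
  #[ map (suc ∘ toℕ) (toList w) ≤ q ]    ≡⟨ ∑-map (suc ∘ toℕ) (toList w) _ ⟩
  ∑[ x ← toList w ] 𝟙 (suc (toℕ x) ≤? q) ≡⟨⟩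
  #[ toList w < q ]                      ∎
  where open ≡-Reasoning

values-positive : (w : Vec (Fin (suc n)) k) → All (1 ≤_) (values w)
values-positive []      = []
values-positive (_ ∷ w) = z<s ∷ values-positive w

-- The height at `zero` is `n`, so `zero` is a minimum exactly when `#[ toList w < q ]` is at least
-- `q` for all `q ≤ n`, which is the counting criterion for parking.
Park : Vec (Fin (suc n)) n → Set
Park w = LeftMin (height (toList w)) zero

park? : (w : Vec (Fin (suc n)) n) → Dec (Park w)
park? w = leftMin? (height (toList w)) zero

park⇒parking : (w : Vec (Fin (suc n)) n) → Park w → IsParkingFunction (values w)
park⇒parking {n} w (min , _) = #⇒parking (values-positive w) λ i →
  subst (toℕ i <_) (sym (#≤-values w (suc (toℕ i)))) (begin
    suc (toℕ i)                     ≡⟨ m∸[m∸n]≡n (toℕ<n i) ⟨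
    n ∸ (n ∸ suc (toℕ i))           ≤⟨ ∸-monoˡ-≤ (n ∸ suc (toℕ i)) (begin
      n                                             ≤⟨ m≤n+m n #[ toList w < 0 ] ⟩
      #[ toList w < 0 ] + n                         ≤⟨ min (suc i) ⟩
      #[ toList w < suc (toℕ i) ] + (n ∸ suc (toℕ i)) ∎) ⟩
    #[ toList w < suc (toℕ i) ] + (n ∸ suc (toℕ i)) ∸ (n ∸ suc (toℕ i))
      ≡⟨ m+n∸n≡m _ (n ∸ suc (toℕ i)) ⟩
    #[ toList w < suc (toℕ i) ] ∎)
  where open ≤-Reasoning

parking⇒park : (w : Vec (Fin (suc n)) n) → IsParkingFunction (values w) → Park w
parking⇒park {n} w park = min , λ _ _ → z≤n
  where
  open ≤-Reasoning
  min : ∀ p → height (toList w) zero ≤ height (toList w) p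
  min zero    = ≤-refl
  min (suc i) = begin
    #[ toList w < 0 ] + n                 ≡⟨ cong (_+ n) (#<0 (toList w)) ⟩
    n                                     ≡⟨ m+[n∸m]≡n (toℕ<n i) ⟨
    suc (toℕ i) + (n ∸ suc (toℕ i))
      ≤⟨ +-monoˡ-≤ (n ∸ suc (toℕ i)) (subst (toℕ i <_) (#≤-values w (suc (toℕ i))) (parking⇒# park i)) ⟩
    #[ toList w < suc (toℕ i) ] + (n ∸ suc (toℕ i)) ∎

-- Comparing the heights at `zero` and at the last place shows that all `n` letters lie below `n`.
leftMin-zero⇒<n : (l : List (Fin (suc n))) → length l ≡ n → LeftMin (height l) zero →
  All.All (λ x → toℕ x < n) l
leftMin-zero⇒<n {n} l len (min , _) = ∑-full (λ x → toℕ x <? n) l (begin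
  length l                                             ≡⟨ len ⟩
  n                                                    ≤⟨ m≤n+m n #[ l < 0 ] ⟩
  #[ l < 0 ] + n                                       ≤⟨ min (fromℕ n) ⟩
  #[ l < toℕ (fromℕ n) ] + (n ∸ toℕ (fromℕ n))         ≡⟨ cong (λ q → #[ l < q ] + (n ∸ q)) (toℕ-fromℕ n) ⟩
  #[ l < n ] + (n ∸ n)                                 ≡⟨ cong (λ y → #[ l < n ] + y) (n∸n≡0 n) ⟩
  #[ l < n ] + 0                                       ≡⟨ +-identityʳ #[ l < n ] ⟩
  #[ l < n ]                                           ∎)
  where open ≤-Reasoning

-- Cardinalities of setoids

module _ (S : Setoid 0ℓ 0ℓ) where
  open Setoid S using (Carrier; _≈_) renaming (refl to ≈-refl; sym to ≈-sym; trans to ≈-trans)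

  lookup-distinct : {xs : List Carrier} → AllPairs (λ x y → ¬ x ≈ y) xs → ∀ i j →
    List.lookup xs i ≈ List.lookup xs j → i ≡ j
  lookup-distinct (x≉ ∷ _)  zero    zero    _  = refl
  lookup-distinct (x≉ ∷ _)  zero    (suc j) eq = contradiction eq (All.lookup x≉ (∈-lookup j))
  lookup-distinct (x≉ ∷ _)  (suc i) zero    eq = contradiction (≈-sym eq) (All.lookup x≉ (∈-lookup i))
  lookup-distinct (_ ∷ xs!) (suc i) (suc j) eq = cong suc (lookup-distinct xs! i j eq)

  representatives⇒cardinality : (xs : List Carrier) → (∀ x → Any (x ≈_) xs) →
    AllPairs (λ x y → ¬ x ≈ y) xs → HasCardinality S (length xs)
  representatives⇒cardinality xs complete distinct = record
    { to        = List.lookup xs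
    ; from      = from
    ; to-cong   = λ { refl → ≈-refl }
    ; from-cong = λ {x} {y} x≈y → lookup-distinct distinct _ _
        (≈-trans (≈-sym (to-from x)) (≈-trans x≈y (to-from y)))
    ; inverse   = (λ { {x} refl → ≈-sym (to-from x) })
                , (λ {i} {y} y≈ → lookup-distinct distinct _ _ (≈-trans (≈-sym (to-from y)) y≈))
    }
    where
    from : Carrier → Fin (length xs)
    from x = Any.index (complete x)
    to-from : ∀ x → x ≈ List.lookup xs (from x)
    to-from x = Anyₚ.lookup-index (complete x)

  cardinality-unique : {a b : ℕ} → HasCardinality S a → HasCardinality S b → a ≡ b
  cardinality-unique p q = ↔⇒≡ (Composition.inverse p (Symmetry.inverse q))

select : {P : A → Set} → (∀ x → Dec (P x)) → List A → List (Σ[ x ∈ A ] P x)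
select P? []       = []
select P? (x ∷ xs) with P? x
... | yes p = (x , p) ∷ select P? xs
... | no  _ = select P? xs

length-select : {P : A → Set} (P? : ∀ x → Dec (P x)) (xs : List A) →
  length (select P? xs) ≡ ∑[ x ← xs ] 𝟙 (P? x)
length-select P? []       = refl
length-select P? (x ∷ xs) with P? x
... | yes _ = cong suc (length-select P? xs)
... | no  _ = length-select P? xs

∈-select : {P : A → Set} (P? : ∀ x → Dec (P x)) {xs : List A} {x : A} → x ∈ xs → P x →
  Any (λ y → x ≡ proj₁ y) (select P? xs)
∈-select P? {y ∷ _} (here refl) p with P? y
... | yes _  = here refl
... | no ¬p  = contradiction p ¬p
∈-select P? {y ∷ _} (there x∈xs) p with P? y
... | yes _  = there (∈-select P? x∈xs p)
... | no  _  = ∈-select P? x∈xs p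

select-! : {P : A → Set} (P? : ∀ x → Dec (P x)) {xs : List A} → Unique xs →
  AllPairs (λ x y → ¬ proj₁ x ≡ proj₁ y) (select P? xs)
select-! P? []         = []
select-! P? {x ∷ xs} (x∉ ∷ xs!) with P? x
... | yes _ = all x∉ ∷ select-! P? xs!
  where
  all : ∀ {ys} → All.All (x ≢_) ys → All.All (λ y → ¬ x ≡ proj₁ y) (select P? ys)
  all []                = []
  all {y ∷ ys} (≢ ∷ as) with P? y
  ... | yes _ = ≢ ∷ all as
  ... | no  _ = all as
... | no  _ = select-! P? xs!

V⇒L-unique : {v : Vec A k} → V.Unique v → Unique (toList v)
V⇒L-unique []         = []
V⇒L-unique (x∉ ∷ xs!) = VAllₚ.toList⁺ x∉ ∷ V⇒L-unique xs!

L⇒V-unique : {v : Vec A k} → Unique (toList v) → V.Unique v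
L⇒V-unique {v = []}    []         = []
L⇒V-unique {v = _ ∷ _} (x∉ ∷ xs!) = VAllₚ.toList⁻ x∉ ∷ L⇒V-unique xs!

unique-resp-↭ : {u : Vec A k} {v : Vec A l} → toList u ↭ toList v → V.Unique u → V.Unique v
unique-resp-↭ {A = A} p u! = L⇒V-unique (SetoidPerm.Unique-resp-↭ (setoid A) (↭⇒↭ₛ p) (V⇒L-unique u!))

-- Cycles and their rotations

toList-rotate-↭ : (v : Vec A k) → toList (rotate v) ↭ toList v
toList-rotate-↭ []      = ↭-refl
toList-rotate-↭ (x ∷ v) = ↭-trans (↭-reflexive (toList-∷ʳ x v)) (Permₚ.++-comm (toList v) (x ∷ []))

toList-iterate-↭ : (v : Vec A k) (j : ℕ) → toList (iterate rotate v j) ↭ toList v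
toList-iterate-↭ v zero    = ↭-refl
toList-iterate-↭ v (suc j) = ↭-trans (toList-iterate-↭ (rotate v) j) (toList-rotate-↭ v)

map-rotate : (f : A → B) (v : Vec A k) → Vec.map f (rotate v) ≡ rotate (Vec.map f v)
map-rotate f []      = refl
map-rotate f (x ∷ v) = map-∷ʳ f x v

lookup-∷ʳ-inject₁ : (v : Vec A k) (x : A) (i : Fin k) → lookup (v ∷ʳ x) (inject₁ i) ≡ lookup v i
lookup-∷ʳ-inject₁ (_ ∷ _) x zero    = refl
lookup-∷ʳ-inject₁ (_ ∷ v) x (suc i) = lookup-∷ʳ-inject₁ v x i

-- One rotation moves the entry at `suc i` to `inject₁ i`; hence the induction on the index, over
-- all vectors at once.
rotate-to-lookup : (i : Fin (suc k)) (v : Vec A (suc k)) → ∃[ j ] head (iterate rotate v j) ≡ lookup v i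
rotate-to-lookup = <-weakInduction (λ i → ∀ v → ∃[ j ] head (iterate rotate v j) ≡ lookup v i)
  (λ { (_ ∷ _) → 0 , refl })
  (λ { i ih (x ∷ v) → let j , eq = ih (v ∷ʳ x) in suc j , trans eq (lookup-∷ʳ-inject₁ v x i) })

rotate-to : {v : Vec A (suc k)} {x : A} → x ∈ toList v → ∃[ j ] head (iterate rotate v j) ≡ x
rotate-to x∈v = let j , eq = rotate-to-lookup (VAny.index (∈-toList⁻ x∈v)) _ in
  j , trans eq (sym (VAnyₚ.lookup-index (∈-toList⁻ x∈v)))

head-∈ : (v : Vec A (suc k)) → head v ∈ toList v
head-∈ (_ ∷ _) = here refl

infix 4 _∈?_
_∈?_ : (i : Fin n) (l : List (Fin n)) → Dec (i ∈ l)
_∈?_ = mem? Fin._≟_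

Disjoint : Vec (Fin n) k → Vec (Fin n) l → Set
Disjoint u v = VAll.All (λ i → VAll.All (i ≢_) v) u

disjoint? : (u : Vec (Fin n) k) (v : Vec (Fin n) l) → Dec (Disjoint u v)
disjoint? u v = VAll.all? (λ i → VAll.all? (λ j → ¬? (i Fin.≟ j)) v) u

disjoint⁺ : {u : Vec (Fin n) k} {v : Vec (Fin n) l} →
  (∀ {i} → i ∈ toList u → i ∉ toList v) → Disjoint u v
disjoint⁺ sep = VAllₚ.toList⁻ (All.tabulate λ i∈u →
  VAllₚ.toList⁻ (All.tabulate λ { j∈v refl → sep i∈u j∈v }))

disjoint⁻ : {u : Vec (Fin n) k} {v : Vec (Fin n) l} → Disjoint u v →
  ∀ {i} → i ∈ toList u → i ∉ toList v
disjoint⁻ d i∈u i∈v = All.lookup (VAllₚ.toList⁺ (All.lookup (VAllₚ.toList⁺ d) i∈u)) i∈v refl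

module _ {n : ℕ} (π : Vec ℕ n) where

  abstract
    isCycle? : (v : Vec (Fin n) k) → Dec (IsCycle π v)
    isCycle? v = VPairs.allPairs? (λ i j → ¬? (i Fin.≟ j)) v ×-dec
      Vecₚ.≡-dec ℕ._≟_ (Vec.map (lookup π) v) (Vec.map (suc ∘ toℕ) (rotate v))

  rotate-cycle : {v : Vec (Fin n) k} → IsCycle π v → IsCycle π (rotate v)
  rotate-cycle {v = v} (v! , eq) = unique-resp-↭ (↭-sym (toList-rotate-↭ v)) v! , (begin
    Vec.map (lookup π) (rotate v)           ≡⟨ map-rotate (lookup π) v ⟩
    rotate (Vec.map (lookup π) v)           ≡⟨ cong rotate eq ⟩
    rotate (Vec.map (suc ∘ toℕ) (rotate v)) ≡⟨ map-rotate (suc ∘ toℕ) (rotate v) ⟨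
    Vec.map (suc ∘ toℕ) (rotate (rotate v)) ∎)
    where open ≡-Reasoning

  private
    successors-agree : ∀ {x a b} (u v : Vec (Fin n) k) →
      Vec.map (lookup π) (x ∷ u) ≡ Vec.map (suc ∘ toℕ) (u ∷ʳ a) →
      Vec.map (lookup π) (x ∷ v) ≡ Vec.map (suc ∘ toℕ) (v ∷ʳ b) → u ≡ v
    successors-agree []      []      _ _ = refl
    successors-agree (y ∷ u) (z ∷ v) p q
      with toℕ-injective (ℕ.suc-injective (trans (sym (∷-injectiveˡ p)) (∷-injectiveˡ q)))
    ... | refl = cong (y ∷_) (successors-agree u v (∷-injectiveʳ p) (∷-injectiveʳ q))

  -- The value of `π` at an index of a cycle names the next index, so the tuple unrolls from its
  -- head.
  cycle-determined-by-head : {u v : Vec (Fin n) (suc k)} → IsCycle π u → IsCycle π v →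
    head u ≡ head v → u ≡ v
  cycle-determined-by-head {u = x ∷ u} {v = .x ∷ v} (_ , p) (_ , q) refl =
    cong (x ∷_) (successors-agree u v p q)

  -- A family of cycles instead of all of them, so that the same counts apply again after the cycles
  -- meeting a chosen one are discarded.
  record RotationClosed (A : Vec (Fin n) (suc k) → Set) : Set where
    field
      cycle  : ∀ {v} → A v → IsCycle π v
      rotate⁺ : ∀ {v} → A v → A (rotate v)

    iterate⁺ : ∀ {v} j → A v → A (iterate rotate v j)
    iterate⁺ zero    a = a
    iterate⁺ (suc j) a = iterate⁺ j (rotate⁺ a)

    -- Rotating both cycles until the common index comes first makes them coincide. Thus
    -- inequivalent cycles are disjoint, the fact on which the inclusion-exclusion rests.
    ~-of-common : ∀ {u v i} → A u → A v → i ∈ toList u → i ∈ toList v → u ~ v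
    ~-of-common {u} {v} a b i∈u i∈v =
      let j , p = rotate-to i∈u
          l , q = rotate-to i∈v
      in ~-trans (j , cycle-determined-by-head (cycle (iterate⁺ j a)) (cycle (iterate⁺ l b)) (trans p (sym q)))
                 (~-sym (l , refl))

  allCycles : RotationClosed {k} (IsCycle π)
  allCycles = record { cycle = id ; rotate⁺ = rotate-cycle }

  ~⇒head∈ : {u v : Vec (Fin n) (suc k)} → u ~ v → head u ∈ toList v
  ~⇒head∈ {u = u} (j , refl) = ∈-resp-↭ (↭-sym (toList-iterate-↭ u j)) (head-∈ u)

  module _ {k : ℕ} {A : Vec (Fin n) (suc k) → Set} (A? : ∀ v → Dec (A v)) (closed : RotationClosed A) where
    open RotationClosed closed

    private
      vs : List (Vec (Fin n) (suc k))
      vs = vecs (allFin n) (suc k)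

    -- A cycle meets v exactly when its head lies on v, and each index of v is the head of
    -- exactly one cycle.
    ∑-meeting : ∀ {v} → A v → ∑[ u ← vs ] (𝟙 (A? u) * 𝟙 (head u ∈? toList v)) ≡ suc k
    ∑-meeting {v} a = begin
      ∑[ u ← vs ] (𝟙 (A? u) * 𝟙 (head u ∈? toList v))
        ≡⟨ ∑-cong vs (λ u → trans (cong (𝟙 (A? u) *_) (∑-∈ Fin._≟_ (toList v) (V⇒L-unique (proj₁ (cycle a))) (head u ∈? toList v)))
             (sym (∑-*ˡ (toList v) (𝟙 (A? u)) _))) ⟩
      ∑[ u ← vs ] ∑[ i ← toList v ] (𝟙 (A? u) * 𝟙 (head u Fin.≟ i))
        ≡⟨ ∑-swap vs (toList v) _ ⟩
      ∑[ i ← toList v ] ∑[ u ← vs ] (𝟙 (A? u) * 𝟙 (head u Fin.≟ i))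
        ≡⟨ ∑-cong-∈ (toList v) (λ {i} i∈v → trans (∑-cong vs (λ u → sym (𝟙-× (A? u) (head u Fin.≟ i)))) (one i∈v)) ⟩
      ∑[ i ← toList v ] 1
        ≡⟨ ∑-1 (toList v) ⟩
      length (toList v)
        ≡⟨ length-toList v ⟩
      suc k ∎
      where
      open ≡-Reasoning
      one : ∀ {i} → i ∈ toList v → ∑[ u ← vs ] 𝟙 (A? u ×-dec (head u Fin.≟ i)) ≡ 1
      one {i} i∈v = let j , eq = rotate-to i∈v in
        ∑-unique (λ u → A? u ×-dec (head u Fin.≟ i)) (vecs! (Uniq.allFin⁺ n) (suc k))
          (∈-vecs ∈-allFin (iterate rotate v j)) (iterate⁺ j a , eq)
          (λ (b , eq′) → cycle-determined-by-head (cycle b) (cycle (iterate⁺ j a)) (trans eq′ (sym eq)))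

    closed-disjoint : (v : Vec (Fin n) (suc k)) → RotationClosed (λ u → A u × Disjoint v u)
    closed-disjoint v = record
      { cycle   = λ (a , _) → cycle a
      ; rotate⁺ = λ {u} (a , d) → rotate⁺ a ,
          disjoint⁺ (λ i∈v i∈u → disjoint⁻ d i∈v (∈-resp-↭ (toList-rotate-↭ u) i∈u))
      }

    -- A member of the family is either disjoint from `v` or a rotation of `v`, and its head alone
    -- tells which; `∑-meeting` counts the second kind.
    ∑-disjoint : ∀ {v} → A v → (∑[ u ← vs ] 𝟙 (A? u ×-dec disjoint? v u)) + suc k ≡ ∑[ u ← vs ] 𝟙 (A? u)
    ∑-disjoint {v} a = begin
      (∑[ u ← vs ] 𝟙 (A? u ×-dec disjoint? v u)) + suc k
        ≡⟨ cong₂ _+_ (∑-cong vs (λ u → 𝟙-× (A? u) _)) (sym (∑-meeting a)) ⟩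
      (∑[ u ← vs ] (𝟙 (A? u) * 𝟙 (disjoint? v u))) + (∑[ u ← vs ] (𝟙 (A? u) * 𝟙 (head u ∈? toList v)))
        ≡⟨ ∑-+ vs _ _ ⟨
      ∑[ u ← vs ] (𝟙 (A? u) * 𝟙 (disjoint? v u) + 𝟙 (A? u) * 𝟙 (head u ∈? toList v))
        ≡⟨ ∑-cong vs (λ u → trans (sym (*-distribˡ-+ (𝟙 (A? u)) _ _))
             (trans (𝟙-*-cong (A? u) (dichotomy u)) (*-identityʳ _))) ⟩
      ∑[ u ← vs ] 𝟙 (A? u) ∎
      where
      open ≡-Reasoning
      dichotomy : ∀ u → A u → 𝟙 (disjoint? v u) + 𝟙 (head u ∈? toList v) ≡ 1
      dichotomy u b = trans (+-comm _ (𝟙 (head u ∈? toList v)))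
        (trans (cong (λ y → 𝟙 (head u ∈? toList v) + y) (𝟙-cong (disjoint? v u) (¬? (head u ∈? toList v))
          (λ d h∈v → disjoint⁻ d h∈v (head-∈ u))
          (λ h∉v → disjoint⁺ λ i∈v i∈u → h∉v (~⇒head∈ (~-of-common b a i∈u i∈v)))))
        (𝟙-¬ (head u ∈? toList v)))

-- Families of disjoint cycles

infixl 8 _↓_
-- The falling factorial. The truncation `pred 0 = 0` is harmless: when it occurs, the factor 0 has
-- already entered the product.
_↓_ : ℕ → ℕ → ℕ
c ↓ zero  = 1
c ↓ suc j = c * (pred c ↓ j)

DisjointFamily : {j : ℕ} → (Vec (Fin n) k → Set) → Vec (Vec (Fin n) k) j → Set
DisjointFamily A t = VPairs.AllPairs Disjoint t × VAll.All A t

disjointFamily? : {j : ℕ} {A : Vec (Fin n) k → Set} → (∀ v → Dec (A v)) →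
  (t : Vec (Vec (Fin n) k) j) → Dec (DisjointFamily A t)
disjointFamily? A? t = VPairs.allPairs? disjoint? t ×-dec VAll.all? A? t

-- Disjointness from `v` moves into the predicate, which leaves a shorter problem of the same shape
-- for the tail.
𝟙-disjointFamily-∷ : {j : ℕ} {A : Vec (Fin n) k → Set} (A? : ∀ v → Dec (A v))
  (v : Vec (Fin n) k) (t : Vec (Vec (Fin n) k) j) →
  𝟙 (disjointFamily? A? (v ∷ t)) ≡
  𝟙 (A? v) * 𝟙 (disjointFamily? (λ u → A? u ×-dec disjoint? v u) t)
𝟙-disjointFamily-∷ A? v t = trans
  (𝟙-cong _ (A? v ×-dec disjointFamily? (λ u → A? u ×-dec disjoint? v u) t)
    (λ { (d ∷ ds , a ∷ as) → a , ds , VAll.zip (as , d) })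
    (λ { (a , ds , asd) → let as , d = VAll.unzip asd in d ∷ ds , a ∷ as }))
  (𝟙-× (A? v) _)

module _ {n : ℕ} (π : Vec ℕ n) where

  private
    vs : (k : ℕ) → List (Vec (Fin n) (suc k))
    vs k = vecs (allFin n) (suc k)

  -- Once a first cycle v is chosen, the cycles disjoint from v again form a rotation-closed
  -- family, with suc k fewer members.
  ∑-disjointFamily : (j c : ℕ) {A : Vec (Fin n) (suc k) → Set} (A? : ∀ v → Dec (A v)) →
    RotationClosed π A → ∑[ u ← vs k ] 𝟙 (A? u) ≡ c * suc k →
    ∑[ t ← vecs (vs k) j ] 𝟙 (disjointFamily? A? t) ≡ suc k ^ j * c ↓ j
  ∑-disjointFamily {k} zero c A? closed count = refl
  ∑-disjointFamily {k} (suc j) c {A} A? closed count = begin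
    ∑[ t ← vecs (vs k) (suc j) ] 𝟙 (disjointFamily? A? t)
      ≡⟨ ∑-vecs-suc (vs k) _ ⟩
    ∑[ v ← vs k ] ∑[ t ← vecs (vs k) j ] 𝟙 (disjointFamily? A? (v ∷ t))
      ≡⟨ ∑-cong (vs k) (λ v → trans (∑-cong (vecs (vs k) j) (𝟙-disjointFamily-∷ A? v)) (∑-*ˡ (vecs (vs k) j) (𝟙 (A? v)) _)) ⟩
    ∑[ v ← vs k ] (𝟙 (A? v) * (∑[ t ← vecs (vs k) j ] 𝟙 (disjointFamily? (λ u → A? u ×-dec disjoint? v u) t)))
      ≡⟨ ∑-cong (vs k) (λ v → 𝟙-*-cong (A? v) (remaining v)) ⟩
    ∑[ v ← vs k ] (𝟙 (A? v) * (suc k ^ j * pred c ↓ j))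
      ≡⟨ ∑-*ʳ (vs k) _ _ ⟩
    (∑[ v ← vs k ] 𝟙 (A? v)) * (suc k ^ j * pred c ↓ j)
      ≡⟨ cong (_* (suc k ^ j * pred c ↓ j)) count ⟩
    c * suc k * (suc k ^ j * pred c ↓ j)
      ≡⟨ rearrange c (suc k) (suc k ^ j) (pred c ↓ j) ⟩
    suc k ^ suc j * c ↓ suc j ∎
    where
    open ≡-Reasoning
    rearrange : ∀ c m p d → c * m * (p * d) ≡ m * p * (c * d)
    rearrange = solve-∀
    -- With `c = 0` there would be no room for the rotations of `v` itself, so `pred` never
    -- truncates here.
    count-disjoint : ∀ c {x} → x + suc k ≡ c * suc k → x ≡ pred c * suc k
    count-disjoint zero    {x} eq = contradiction (trans (sym (+-suc x k)) eq) λ ()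
    count-disjoint (suc c) {x} eq = +-cancelʳ-≡ (suc k) _ _ (trans eq (+-comm (suc k) (c * suc k)))
    remaining : ∀ v → A v → ∑[ t ← vecs (vs k) j ] 𝟙 (disjointFamily? (λ u → A? u ×-dec disjoint? v u) t) ≡
      suc k ^ j * pred c ↓ j
    remaining v a = ∑-disjointFamily j (pred c) (λ u → A? u ×-dec disjoint? v u)
      (closed-disjoint π A? closed v)
      (count-disjoint c (trans (∑-disjoint π A? closed a) count))

  private
    cycleSetoid : ℕ → DecSetoid 0ℓ 0ℓ
    cycleSetoid k = record
      { Carrier = Setoid.Carrier (Cycles (suc k) π)
      ; _≈_ = Setoid._≈_ (Cycles (suc k) π)
      ; isDecEquivalence = record
        { isEquivalence = Setoid.isEquivalence (Cycles (suc k) π)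
        -- Two cycles are rotations of each other exactly when the head of one lies on the other,
        -- which is decidable.
        ; _≟_ = λ (u , cu) (v , cv) → map′
            (λ h∈v → RotationClosed.~-of-common (allCycles π) cu cv (head-∈ u) h∈v)
            (~⇒head∈ π) (head u ∈? toList v)
        }
      }

  -- Double counting of pairs of a cycle tuple and a class representative containing its head: each
  -- tuple has one such representative, and each representative has `suc k` such tuples, its
  -- rotations.
  cycles-cardinality : (k : ℕ) → ∃[ c ] HasCardinality (Cycles (suc k) π) c ×
    ∑[ u ← vs k ] 𝟙 (isCycle? π u) ≡ c * suc k
  cycles-cardinality k = length reps ,
    representatives⇒cardinality S reps complete distinct ,
    (begin
      ∑[ u ← vs k ] 𝟙 (isCycle? π u)
        ≡⟨ ∑-cong (vs k) (λ u → trans (sym (*-identityʳ _)) (𝟙-*-cong (isCycle? π u) (sym ∘ one u))) ⟩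
      ∑[ u ← vs k ] (𝟙 (isCycle? π u) * (∑[ r ← reps ] 𝟙 (head u ∈? toList (proj₁ r))))
        ≡⟨ ∑-cong (vs k) (λ u → sym (∑-*ˡ reps (𝟙 (isCycle? π u)) _)) ⟩
      ∑[ u ← vs k ] ∑[ r ← reps ] (𝟙 (isCycle? π u) * 𝟙 (head u ∈? toList (proj₁ r)))
        ≡⟨ ∑-swap (vs k) reps _ ⟩
      ∑[ r ← reps ] ∑[ u ← vs k ] (𝟙 (isCycle? π u) * 𝟙 (head u ∈? toList (proj₁ r)))
        ≡⟨ ∑-cong reps (λ r → ∑-meeting π (isCycle? π) (allCycles π) (proj₂ r)) ⟩
      ∑[ r ← reps ] suc k
        ≡⟨ ∑-const reps (suc k) ⟩
      length reps * suc k ∎)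
    where
    open ≡-Reasoning
    S = Cycles (suc k) π
    open DecSetoid (cycleSetoid k) using (_≈_) renaming (_≟_ to _≈?_; sym to ≈-sym; trans to ≈-trans)
    enumeration : List (Setoid.Carrier S)
    enumeration = select (isCycle? π) (vs k)
    reps : List (Setoid.Carrier S)
    reps = deduplicate _≈?_ enumeration
    distinct : AllPairs (λ x y → ¬ x ≈ y) reps
    distinct = deduplicate-! (cycleSetoid k) enumeration
    complete : ∀ x → Any (x ≈_) reps
    complete x = SetoidMembership.∈-deduplicate⁺ S _≈?_ (λ {x} {y} {z} p q → ≈-trans {x} {y} {z} q (≈-sym {z} {y} p)) {xs = enumeration} {z = x}
      (Any.map (λ { eq → 0 , eq }) (∈-select (isCycle? π) (∈-vecs ∈-allFin (proj₁ x)) (proj₂ x)))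
    one : ∀ u → IsCycle π u → ∑[ r ← reps ] 𝟙 (head u ∈? toList (proj₁ r)) ≡ 1
    one u cu = ∑-one (λ r → head u ∈? toList (proj₁ r))
      (AllPairs.map (λ {x} {y} x≉y u∈x u∈y → x≉y (RotationClosed.~-of-common (allCycles π) (proj₂ x) (proj₂ y) u∈x u∈y)) distinct)
      (Any.map (~⇒head∈ π) (complete (u , cu)))

-- Disjoint cycles as prescribed letters of a word

V-map-injective : {f : A → B} → (∀ {x y} → f x ≡ f y → x ≡ y) → (u v : Vec A k) →
  Vec.map f u ≡ Vec.map f v → u ≡ v
V-map-injective inj []      []      _  = refl
V-map-injective inj (_ ∷ u) (_ ∷ v) eq =
  cong₂ _∷_ (inj (∷-injectiveˡ eq)) (V-map-injective inj u v (∷-injectiveʳ eq))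

abstract
  unique? : (v : Vec (Fin n) k) → Dec (V.Unique v)
  unique? = VPairs.allPairs? (λ i j → ¬? (i Fin.≟ j))

V-unique-++⁻ : (u : Vec A k) {v : Vec A l} → V.Unique (u Vec.++ v) →
  V.Unique u × V.Unique v × VAll.All (λ x → VAll.All (x ≢_) v) u
V-unique-++⁻ []      v!         = [] , v! , []
V-unique-++⁻ (x ∷ u) (x∉ ∷ uv!) with VAllₚ.++⁻ u x∉ | V-unique-++⁻ u uv!
... | x∉u , x∉v | u! , v! , d = x∉u ∷ u! , v! , x∉v ∷ d

V-unique-concat⁻ : (t : Vec (Vec A k) q) → V.Unique (Vec.concat t) →
  VAll.All V.Unique t × VPairs.AllPairs (λ u v → VAll.All (λ x → VAll.All (x ≢_) v) u) t
V-unique-concat⁻ []      _  = [] , []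
V-unique-concat⁻ (v ∷ t) c! with V-unique-++⁻ v c!
... | v! , t! , d with V-unique-concat⁻ t t!
... | us , ds = v! ∷ us ,
  VAllₚ.All-swap (VAll.map (λ {x} → VAllₚ.concat⁻ t) d) ∷ ds

toList-concat-rotate-↭ : (t : Vec (Vec A k) q) →
  toList (Vec.concat (Vec.map rotate t)) ↭ toList (Vec.concat t)
toList-concat-rotate-↭ []      = ↭-refl
toList-concat-rotate-↭ (v ∷ t) = begin
  toList (rotate v Vec.++ Vec.concat (Vec.map rotate t))      ≡⟨ toList-++ (rotate v) _ ⟩
  toList (rotate v) ++ toList (Vec.concat (Vec.map rotate t)) ↭⟨ Permₚ.++⁺ (toList-rotate-↭ v) (toList-concat-rotate-↭ t) ⟩
  toList v ++ toList (Vec.concat t)                           ≡⟨ toList-++ v _ ⟨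
  toList (v Vec.++ Vec.concat t)                              ∎
  where open PermutationReasoning

module _ (w : Vec (Fin (suc n)) n) where

  private
    word : ∀ {k} → Vec (Fin n) k → Vec (Fin (suc n)) k
    word = Vec.map (lookup w)

    lookup-values : (v : Vec (Fin n) k) →
      Vec.map (lookup (values w)) v ≡ Vec.map (ℕ.suc ∘ toℕ) (word v)
    lookup-values v = trans (Vecₚ.map-cong (λ i → lookup-map i (ℕ.suc ∘ toℕ) w) v) (Vecₚ.map-∘ (ℕ.suc ∘ toℕ) (lookup w) v)

    inject₁-values : (u : Vec (Fin n) k) →
      Vec.map (ℕ.suc ∘ toℕ) u ≡ Vec.map (ℕ.suc ∘ toℕ) (Vec.map inject₁ u)
    inject₁-values u = trans (Vecₚ.map-cong (λ i → cong ℕ.suc (sym (toℕ-inject₁ i))) u) (Vecₚ.map-∘ (ℕ.suc ∘ toℕ) inject₁ u)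

    CycleEq : Vec (Fin n) k → Set
    CycleEq v = Vec.map (lookup (values w)) v ≡ Vec.map (ℕ.suc ∘ toℕ) (rotate v)

    block⇒ : (v : Vec (Fin n) k) → CycleEq v → word v ≡ Vec.map inject₁ (rotate v)
    block⇒ v eq = V-map-injective (toℕ-injective ∘ ℕ.suc-injective) _ _
      (trans (sym (lookup-values v)) (trans eq (inject₁-values (rotate v))))

    block⇐ : (v : Vec (Fin n) k) → word v ≡ Vec.map inject₁ (rotate v) → CycleEq v
    block⇐ v eq = trans (lookup-values v)
      (trans (cong (Vec.map (ℕ.suc ∘ toℕ)) eq) (sym (inject₁-values (rotate v))))

    ++-eq : (v : Vec (Fin n) k) (r : Vec (Fin n) l) (v′ : Vec (Fin n) k) (r′ : Vec (Fin n) l) →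
      word v ≡ Vec.map inject₁ v′ → word r ≡ Vec.map inject₁ r′ →
      word (v Vec.++ r) ≡ Vec.map inject₁ (v′ Vec.++ r′)
    ++-eq v r v′ r′ p q =
      trans (Vecₚ.map-++ (lookup w) v r) (trans (cong₂ Vec._++_ p q) (sym (Vecₚ.map-++ inject₁ v′ r′)))

    ++-eq⁻ : (v : Vec (Fin n) k) (r : Vec (Fin n) l) (v′ : Vec (Fin n) k) (r′ : Vec (Fin n) l) →
      word (v Vec.++ r) ≡ Vec.map inject₁ (v′ Vec.++ r′) →
      word v ≡ Vec.map inject₁ v′ × word r ≡ Vec.map inject₁ r′
    ++-eq⁻ v r v′ r′ eq = Vecₚ.++-injective (word v) (Vec.map inject₁ v′)
      (trans (sym (Vecₚ.map-++ (lookup w) v r)) (trans eq (Vecₚ.map-++ inject₁ v′ r′)))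

    blocks⇒ : (t : Vec (Vec (Fin n) k) q) → VAll.All (IsCycle (values w)) t →
      word (Vec.concat t) ≡ Vec.map inject₁ (Vec.concat (Vec.map rotate t))
    blocks⇒ []      []             = refl
    blocks⇒ (v ∷ t) ((_ , c) ∷ cs) = ++-eq v _ (rotate v) _ (block⇒ v c) (blocks⇒ t cs)

    blocks⇐ : (t : Vec (Vec (Fin n) k) q) → VAll.All V.Unique t →
      word (Vec.concat t) ≡ Vec.map inject₁ (Vec.concat (Vec.map rotate t)) →
      VAll.All (IsCycle (values w)) t
    blocks⇐ []      []        _  = []
    blocks⇐ (v ∷ t) (v! ∷ us) eq with ++-eq⁻ v _ (rotate v) _ eq
    ... | p , q = (v! , block⇐ v p) ∷ blocks⇐ t us q

  -- Distinctness of the concatenation packs distinctness inside the tuples together with their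
  -- disjointness, and the cycle equations of all tuples merge into one prescription of letters. The
  -- index `i` and the letter `inject₁ i` denote the same number, hence `inject₁`.
  𝟙-disjointCycles : (t : Vec (Vec (Fin n) k) q) →
    𝟙 (disjointFamily? (isCycle? (values w)) t) ≡
    𝟙 (unique? (Vec.concat t)) *
    𝟙 (Vecₚ.≡-dec Fin._≟_ (Vec.map (lookup w) (Vec.concat t)) (Vec.map inject₁ (Vec.concat (Vec.map rotate t))))
  𝟙-disjointCycles t = trans
    (𝟙-cong _ (unique? (Vec.concat t) ×-dec Vecₚ.≡-dec Fin._≟_ _ _)
      (λ (ds , cs) → VPairsₚ.concat⁺ (VAll.map proj₁ cs) ds , blocks⇒ t cs)
      (λ (c! , eq) → let us , ds = V-unique-concat⁻ t c! in ds , blocks⇐ t us eq))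
    (𝟙-× (unique? (Vec.concat t)) _)

-- From cycle indices to words of distinct letters on the circle

∑-vecs-inject₁ : (s : ℕ) (h : Vec (Fin (suc n)) s → ℕ) → (∀ t → fromℕ n ∈ toList t → h t ≡ 0) →
  ∑ (vecs (allFin (suc n)) s) h ≡ ∑ (vecs (allFin n) s) (h ∘ Vec.map inject₁)
∑-vecs-inject₁ zero h _ = refl
∑-vecs-inject₁ {n} (suc s) h top = begin
  ∑ (vecs (allFin (suc n)) (suc s)) h
    ≡⟨ ∑-vecs-suc (allFin (suc n)) h ⟩
  ∑[ x ← allFin (suc n) ] ∑[ t ← vecs (allFin (suc n)) s ] h (x ∷ t)
    ≡⟨ ∑-allFin-inject₁ (λ x → ∑[ t ← vecs (allFin (suc n)) s ] h (x ∷ t)) ⟩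
  (∑[ t ← vecs (allFin (suc n)) s ] h (fromℕ n ∷ t)) + ∑ (allFin n) (λ x → ∑[ t ← vecs (allFin (suc n)) s ] h (inject₁ x ∷ t))
    ≡⟨ cong₂ _+_ (trans (∑-cong (vecs (allFin (suc n)) s) (λ t → top (fromℕ n ∷ t) (here refl))) (∑-0 (vecs (allFin (suc n)) s)))
         (∑-cong (allFin n) (λ x → ∑-vecs-inject₁ s (λ t → h (inject₁ x ∷ t)) (λ t ∈t → top _ (there ∈t)))) ⟩
  ∑ (allFin n) (λ x → ∑[ t ← vecs (allFin n) s ] h (inject₁ x ∷ Vec.map inject₁ t))
    ≡⟨ ∑-vecs-suc (allFin n) _ ⟨
  ∑ (vecs (allFin n) (suc s)) (h ∘ Vec.map inject₁) ∎
  where open ≡-Reasoning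

∑-∉ : {t : Vec (Fin n) k} → V.Unique t → ∑[ x ← allFin n ] 𝟙 (¬? (x ∈? toList t)) ≡ n ∸ k
∑-∉ {n} {k} {t} t! = begin
  ∑[ x ← allFin n ] 𝟙 (¬? (x ∈? toList t))
    ≡⟨ m+n∸m≡n k _ ⟨
  k + (∑[ x ← allFin n ] 𝟙 (¬? (x ∈? toList t))) ∸ k
    ≡⟨ cong (_∸ k) (cong₂ _+_ (sym count∈) refl) ⟩
  (∑[ x ← allFin n ] 𝟙 (x ∈? toList t)) + (∑[ x ← allFin n ] 𝟙 (¬? (x ∈? toList t))) ∸ k
    ≡⟨ cong (_∸ k) (∑-+ (allFin n) _ _) ⟨
  (∑[ x ← allFin n ] (𝟙 (x ∈? toList t) + 𝟙 (¬? (x ∈? toList t)))) ∸ k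
    ≡⟨ cong (_∸ k) (∑-cong (allFin n) (λ x → 𝟙-¬ (x ∈? toList t))) ⟩
  (∑[ _ ← allFin n ] 1) ∸ k
    ≡⟨ cong (_∸ k) (trans (∑-1 (allFin n)) (length-tabulate id)) ⟩
  n ∸ k ∎
  where
  open ≡-Reasoning
  count∈ : ∑[ x ← allFin n ] 𝟙 (x ∈? toList t) ≡ k
  count∈ = begin
    ∑[ x ← allFin n ] 𝟙 (x ∈? toList t)
      ≡⟨ ∑-cong (allFin n) (λ x → ∑-∈ Fin._≟_ (toList t) (V⇒L-unique t!) (x ∈? toList t)) ⟩
    ∑[ x ← allFin n ] ∑[ y ← toList t ] 𝟙 (x Fin.≟ y)
      ≡⟨ ∑-swap (allFin n) (toList t) _ ⟩
    ∑[ y ← toList t ] ∑[ x ← allFin n ] 𝟙 (x Fin.≟ y)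
      ≡⟨ ∑-cong (toList t) (λ y → ∑-unique (Fin._≟ y) (Uniq.allFin⁺ n) (∈-allFin y) refl id) ⟩
    ∑[ y ← toList t ] 1
      ≡⟨ ∑-1 (toList t) ⟩
    length (toList t)
      ≡⟨ length-toList t ⟩
    k ∎

∑-unique-vecs-suc : (n s : ℕ) →
  ∑[ t ← vecs (allFin n) (suc s) ] 𝟙 (unique? t) ≡ (∑[ t ← vecs (allFin n) s ] 𝟙 (unique? t)) * (n ∸ s)
∑-unique-vecs-suc n s = begin
  ∑[ t ← vecs (allFin n) (suc s) ] 𝟙 (unique? t)
    ≡⟨ ∑-vecs-suc (allFin n) _ ⟩
  ∑[ x ← allFin n ] ∑[ t ← vecs (allFin n) s ] 𝟙 (unique? (x ∷ t))
    ≡⟨ ∑-swap (allFin n) (vecs (allFin n) s) _ ⟩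
  ∑[ t ← vecs (allFin n) s ] ∑[ x ← allFin n ] 𝟙 (unique? (x ∷ t))
    ≡⟨ ∑-cong (vecs (allFin n) s) (λ t → trans (∑-cong (allFin n) (λ x → split x t)) (∑-*ˡ (allFin n) (𝟙 (unique? t)) _)) ⟩
  ∑[ t ← vecs (allFin n) s ] (𝟙 (unique? t) * (∑[ x ← allFin n ] 𝟙 (¬? (x ∈? toList t))))
    ≡⟨ ∑-cong (vecs (allFin n) s) (λ t → 𝟙-*-cong (unique? t) ∑-∉) ⟩
  ∑[ t ← vecs (allFin n) s ] (𝟙 (unique? t) * (n ∸ s))
    ≡⟨ ∑-*ʳ (vecs (allFin n) s) (n ∸ s) _ ⟩
  (∑[ t ← vecs (allFin n) s ] 𝟙 (unique? t)) * (n ∸ s) ∎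
  where
  open ≡-Reasoning
  split : ∀ x t → 𝟙 (unique? (x ∷ t)) ≡ 𝟙 (unique? t) * 𝟙 (¬? (x ∈? toList t))
  split x t = trans
    (𝟙-cong (unique? (x ∷ t)) (unique? t ×-dec ¬? (x ∈? toList t))
      (λ { (x∉ ∷ t!) → t! , λ x∈t → All.lookup (VAllₚ.toList⁺ x∉) x∈t refl })
      (λ (t! , x∉t) → VAllₚ.toList⁻ (All.tabulate λ { y∈t refl → x∉t y∈t }) ∷ t!))
    (𝟙-× (unique? t) _)

∑-unique-vecs : (n s : ℕ) → s ≤ n → (∑[ t ← vecs (allFin n) s ] 𝟙 (unique? t)) * (n ∸ s) ! ≡ n !
∑-unique-vecs n zero    _   = trans
  (cong (λ c → (c + 0) * n !) (𝟙-yes (unique? {n} []) [])) (*-identityˡ (n !))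
∑-unique-vecs n (suc s) s<n = begin
  (∑[ t ← vecs (allFin n) (suc s) ] 𝟙 (unique? t)) * (n ∸ suc s) !
    ≡⟨ cong (_* (n ∸ suc s) !) (∑-unique-vecs-suc n s) ⟩
  U * (n ∸ s) * (n ∸ suc s) !
    ≡⟨ *-assoc U (n ∸ s) _ ⟩
  U * ((n ∸ s) * (n ∸ suc s) !)
    ≡⟨ cong (U *_) (subst (λ d → d * (n ∸ suc s) ! ≡ d !) (sym (+-∸-assoc 1 s<n)) refl) ⟩
  U * (n ∸ s) !
    ≡⟨ ∑-unique-vecs n s (<⇒≤ s<n) ⟩
  n ! ∎
  where
  open ≡-Reasoning
  U = ∑[ t ← vecs (allFin n) s ] 𝟙 (unique? t)

𝟙-unique-map : {f : Fin n → Fin l} → (∀ {x y} → f x ≡ f y → x ≡ y) → (t : Vec (Fin n) k) →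
  𝟙 (unique? (Vec.map f t)) ≡ 𝟙 (unique? t)
𝟙-unique-map inj t = 𝟙-cong _ _ V-unique-map⁻ (Vₚ.map⁺ inj)

cyclicPred-injective : {x y : Fin (suc n)} → cyclicPred x ≡ cyclicPred y → x ≡ y
cyclicPred-injective {x = zero}  {zero}  _  = refl
cyclicPred-injective {x = zero}  {suc y} eq = contradiction eq fromℕ≢inject₁
cyclicPred-injective {x = suc x} {zero}  eq = contradiction (sym eq) fromℕ≢inject₁
cyclicPred-injective {x = suc x} {suc y} eq = cong suc (inject₁-injective eq)

∑-park-disjointCycles : (n m j : ℕ) → j * m ≤ n →
  suc n * (∑[ w ← vecs (allFin (suc n)) n ] (𝟙 (park? w) *
    (∑[ t ← vecs (vecs (allFin n) m) j ] 𝟙 (disjointFamily? (isCycle? (values w)) t)))) ≡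
  (∑[ t ← vecs (allFin (suc n)) (j * m) ] 𝟙 (unique? t)) * suc n ^ (n ∸ j * m)
∑-park-disjointCycles n m j s≤n = trans (cong (suc n *_) (begin
  ∑[ w ← W ] (𝟙 (park? w) * (∑[ t ← T ] 𝟙 (disjointFamily? (isCycle? (values w)) t)))
    ≡⟨ ∑-cong W (λ w → sym (∑-*ˡ T (𝟙 (park? w)) _)) ⟩
  ∑[ w ← W ] ∑[ t ← T ] (𝟙 (park? w) * 𝟙 (disjointFamily? (isCycle? (values w)) t))
    ≡⟨ ∑-swap W T _ ⟩
  ∑[ t ← T ] ∑[ w ← W ] (𝟙 (park? w) * 𝟙 (disjointFamily? (isCycle? (values w)) t))
    ≡⟨ ∑-cong T (λ t → trans (∑-cong W (λ w → trans (cong (𝟙 (park? w) *_) (𝟙-disjointCycles w t))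
         (rearrange (𝟙 (park? w)) (𝟙 (unique? (Vec.concat t))) _))) (∑-*ˡ W (𝟙 (unique? (Vec.concat t))) _)) ⟩
  ∑[ t ← T ] (𝟙 (unique? (Vec.concat t)) * (∑[ w ← W ] (𝟙 (park? w) *
    𝟙 (Vecₚ.≡-dec Fin._≟_ (Vec.map (lookup w) (Vec.concat t)) (Vec.map inject₁ (Vec.concat (Vec.map rotate t)))))))
    -- The prescribed letters are the indices themselves, rotated in blocks. As order is ignored,
    -- both the positions and the rotation drop out.
    ≡⟨ ∑-cong T (λ t → 𝟙-*-cong (unique? (Vec.concat t)) (prescribe t)) ⟩
  ∑[ t ← T ] (𝟙 (unique? (Vec.concat t)) * completions (Vec.map inject₁ (Vec.concat t)))
    ≡⟨ ∑-vecs-concat (allFin n) m j (λ t → 𝟙 (unique? t) * completions (Vec.map inject₁ t)) ⟩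
  ∑[ t ← vecs (allFin n) jm ] (𝟙 (unique? t) * completions (Vec.map inject₁ t))
    ≡⟨ ∑-cong (vecs (allFin n) jm) (λ t → cong (_* completions (Vec.map inject₁ t)) (𝟙-unique-map inject₁-injective t)) ⟨
  ∑[ t ← vecs (allFin n) jm ] (𝟙 (unique? (Vec.map inject₁ t)) * completions (Vec.map inject₁ t))
    -- Rotation acts on `n + 1` letters, but indices use only `n` of them. The top letter is let in
    -- at no cost, since a word containing it has no parking completion.
    ≡⟨ ∑-vecs-inject₁ jm (λ t → 𝟙 (unique? t) * completions t) (λ t top∈t →
         trans (cong (𝟙 (unique? t) *_) (no-completions t top∈t)) (*-zeroʳ (𝟙 (unique? t)))) ⟨
  ∑[ t ← vecs (allFin (suc n)) jm ] (𝟙 (unique? t) * completions t)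
    ≡⟨ ∑-cong (vecs (allFin (suc n)) jm) (λ t → sym (∑-*ˡ G (𝟙 (unique? t)) _)) ⟩
  ∑[ t ← vecs (allFin (suc n)) jm ] ∑[ g ← G ] (𝟙 (unique? t) * F (toList t ++ toList g)) ∎))
  (∑-pollak n jm s≤n (λ t → 𝟙 (unique? t)) (𝟙-unique-map cyclicPred-injective))
  where
  open ≡-Reasoning
  jm = j * m
  W = vecs (allFin (suc n)) n
  T = vecs (vecs (allFin n) m) j
  G = vecs (allFin (suc n)) (n ∸ jm)
  F : List (Fin (suc n)) → ℕ
  F l = 𝟙 (leftMin? (height l) zero)
  completions : Vec (Fin (suc n)) jm → ℕ
  completions t = ∑[ g ← G ] F (toList t ++ toList g)
  rearrange : ∀ a b c → a * (b * c) ≡ b * (a * c)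
  rearrange = solve-∀
  prescribe : ∀ t → V.Unique (Vec.concat t) → ∑[ w ← W ] (𝟙 (park? w) *
    𝟙 (Vecₚ.≡-dec Fin._≟_ (Vec.map (lookup w) (Vec.concat t)) (Vec.map inject₁ (Vec.concat (Vec.map rotate t))))) ≡
    completions (Vec.map inject₁ (Vec.concat t))
  prescribe t c! = trans
    (∑-prescribed Fin._≟_ (allFin (suc n)) (Uniq.allFin⁺ (suc n)) ∈-allFin F (leftMin-↭ zero)
      (Vec.concat t) c! (Vec.map inject₁ (Vec.concat (Vec.map rotate t))))
    (∑-cong G λ g → leftMin-↭ zero (Permₚ.++⁺ʳ (toList g) (↭-trans
      (↭-reflexive (toList-map inject₁ (Vec.concat (Vec.map rotate t))))
      (↭-trans (Permₚ.map⁺ inject₁ (toList-concat-rotate-↭ t))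
        (↭-reflexive (sym (toList-map inject₁ (Vec.concat t))))))))
  no-completions : ∀ t → fromℕ n ∈ toList t → completions t ≡ 0
  no-completions t top∈t = trans (∑-cong G λ g → 𝟙-no (leftMin? _ zero) λ min →
    <⇒≢ (All.lookup (leftMin-zero⇒<n (toList t ++ toList g) (len g) min) (∈-++⁺ˡ top∈t)) (toℕ-fromℕ n)) (∑-0 G)
    where
    len : ∀ g → length (toList t ++ toList g) ≡ n
    len g = trans (length-++ (toList t)) (trans (cong₂ _+_ (length-toList t) (length-toList g)) (m+[n∸m]≡n s≤n))

-- Falling factorials and binomial coefficients

↓-zero : ∀ {c j} → c < j → c ↓ j ≡ 0
↓-zero {zero}  {suc j} _   = refl
↓-zero {suc c} {suc j} c<j = trans (cong (suc c *_) (↓-zero (s≤s⁻¹ c<j))) (*-zeroʳ (suc c))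

↓-! : ∀ {c j} → j ≤ c → c ↓ j * (c ∸ j) ! ≡ c !
↓-! {c}     {zero}  _   = *-identityˡ (c !)
↓-! {suc c} {suc j} j≤c = trans (*-assoc (suc c) (c ↓ j) _) (cong (suc c *_) (↓-! (s≤s⁻¹ j≤c)))

-- Splits an ordered choice of cycles into its first `k` and the next `ℓ`. For `c < k` the truncated
-- `c ∸ k` does no harm, because `c ↓ k` is 0.
↓-+ : ∀ c k ℓ → c ↓ (k + ℓ) ≡ c ↓ k * (c ∸ k) ↓ ℓ
↓-+ c       zero    ℓ = sym (*-identityˡ (c ↓ ℓ))
↓-+ zero    (suc k) ℓ = refl
↓-+ (suc c) (suc k) ℓ = trans (cong (suc c *_) (↓-+ c k ℓ)) (sym (*-assoc (suc c) (c ↓ k) _))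

↓-C : ∀ c k → c ↓ k ≡ (c C k) * k !
↓-C c k with k ≤? c
... | no  k≰c = trans (↓-zero (≰⇒> k≰c)) (sym (cong (_* k !) (k>n⇒nCk≡0 (≰⇒> k≰c))))
... | yes k≤c = *-cancelʳ-≡ _ _ ((c ∸ k) !) {{(c ∸ k) !≢0}} (begin
  c ↓ k * (c ∸ k) !           ≡⟨ ↓-! k≤c ⟩
  c !                         ≡⟨ m/n*n≡m {{k !* (c ∸ k) !≢0}} (k![n∸k]!∣n! k≤c) ⟨
  (c ! ℕ./ (k ! * (c ∸ k) !)) {{k !* (c ∸ k) !≢0}} * (k ! * (c ∸ k) !) ≡⟨ cong (_* (k ! * (c ∸ k) !)) (nCk≡n!/k![n-k]! k≤c) ⟨
  (c C k) * (k ! * (c ∸ k) !)   ≡⟨ *-assoc (c C k) (k !) ((c ∸ k) !) ⟨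
  (c C k) * k ! * (c ∸ k) !     ∎)
  where open ≡-Reasoning

-- Alternating sums

∑ℤ : List A → (A → ℤ) → ℤ
∑ℤ xs f = foldr ℤ._+_ 0ℤ (map f xs)

∑ℤ-cong : (xs : List A) {f g : A → ℤ} → (∀ x → f x ≡ g x) → ∑ℤ xs f ≡ ∑ℤ xs g
∑ℤ-cong xs eq = cong (foldr ℤ._+_ 0ℤ) (Listₚ.map-cong eq xs)

∑ℤ-0 : (xs : List A) {f : A → ℤ} → (∀ x → f x ≡ 0ℤ) → ∑ℤ xs f ≡ 0ℤ
∑ℤ-0 []       eq = refl
∑ℤ-0 (x ∷ xs) eq = cong₂ ℤ._+_ (eq x) (∑ℤ-0 xs eq)

∑ℤ-+ : (xs : List A) (f g : A → ℤ) → ∑ℤ xs (λ x → f x ℤ.+ g x) ≡ ∑ℤ xs f ℤ.+ ∑ℤ xs g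
∑ℤ-+ []       f g = refl
∑ℤ-+ (x ∷ xs) f g rewrite ∑ℤ-+ xs f g = interchange (f x) (g x) (∑ℤ xs f) (∑ℤ xs g)
  where
  interchange : ∀ a b c d → (a ℤ.+ b) ℤ.+ (c ℤ.+ d) ≡ (a ℤ.+ c) ℤ.+ (b ℤ.+ d)
  interchange = ℤ-Solver.solve-∀

∑ℤ-*ˡ : (xs : List A) (a : ℤ) (f : A → ℤ) → ∑ℤ xs (λ x → a ℤ.* f x) ≡ a ℤ.* ∑ℤ xs f
∑ℤ-*ˡ []       a f = sym (ℤₚ.*-zeroʳ a)
∑ℤ-*ˡ (x ∷ xs) a f = trans (cong (λ s → a ℤ.* f x ℤ.+ s) (∑ℤ-*ˡ xs a f)) (sym (ℤₚ.*-distribˡ-+ a (f x) (∑ℤ xs f)))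

∑ℤ-∷ʳ : (xs : List A) (x : A) (f : A → ℤ) → ∑ℤ (xs List.∷ʳ x) f ≡ ∑ℤ xs f ℤ.+ f x
∑ℤ-∷ʳ []       x f = ℤₚ.+-comm (f x) 0ℤ
∑ℤ-∷ʳ (y ∷ xs) x f = trans (cong (λ s → f y ℤ.+ s) (∑ℤ-∷ʳ xs x f)) (sym (ℤₚ.+-assoc (f y) (∑ℤ xs f) (f x)))

∑ℤ-upTo-suc : (M : ℕ) (f : ℕ → ℤ) → ∑ℤ (upTo (suc M)) f ≡ ∑ℤ (upTo M) f ℤ.+ f M
∑ℤ-upTo-suc M f = trans (cong (λ xs → ∑ℤ xs f) (sym (upTo-∷ʳ M))) (∑ℤ-∷ʳ (upTo M) M f)

sign : ℕ → ℤ
sign ℓ = -1ℤ ℤ.^ ℓ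

-- By Pascal's rule the partial sums telescope. The exact value for every `M` shows that they vanish
-- as soon as `M` exceeds `d`.
alternating-suc : ∀ d M → ∑ℤ (upTo (suc M)) (λ ℓ → sign ℓ ℤ.* + (suc d C ℓ)) ≡ sign M ℤ.* + (d C M)
alternating-suc d zero    = refl
alternating-suc d (suc M) = begin
  ∑ℤ (upTo (suc (suc M))) (λ ℓ → sign ℓ ℤ.* + (suc d C ℓ))
    ≡⟨ ∑ℤ-upTo-suc (suc M) (λ ℓ → sign ℓ ℤ.* + (suc d C ℓ)) ⟩
  ∑ℤ (upTo (suc M)) (λ ℓ → sign ℓ ℤ.* + (suc d C ℓ)) ℤ.+ sign (suc M) ℤ.* + (suc d C suc M)
    ≡⟨ cong₂ (λ a b → a ℤ.+ sign (suc M) ℤ.* b) (alternating-suc d M)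
         (trans (cong +_ (sym (nCk+nC[k+1]≡[n+1]C[k+1] d M))) (ℤₚ.pos-+ (d C M) (d C suc M))) ⟩
  sign M ℤ.* + (d C M) ℤ.+ -1ℤ ℤ.* sign M ℤ.* (+ (d C M) ℤ.+ + (d C suc M))
    ≡⟨ telescope (sign M) (+ (d C M)) (+ (d C suc M)) ⟩
  -1ℤ ℤ.* sign M ℤ.* + (d C suc M) ∎
  where
  open ≡-Reasoning
  telescope : ∀ s a b → s ℤ.* a ℤ.+ -1ℤ ℤ.* s ℤ.* (a ℤ.+ b) ≡ -1ℤ ℤ.* s ℤ.* b
  telescope = ℤ-Solver.solve-∀

alternating-zero : ∀ M → ∑ℤ (upTo (suc M)) (λ ℓ → sign ℓ ℤ.* + (0 C ℓ)) ≡ 1ℤ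
alternating-zero zero    = refl
alternating-zero (suc M) = trans (∑ℤ-upTo-suc (suc M) (λ ℓ → sign ℓ ℤ.* + (0 C ℓ)))
  (cong₂ ℤ._+_ (alternating-zero M) (trans (cong (λ b → sign (suc M) ℤ.* + b) (k>n⇒nCk≡0 {0} {suc M} z<s)) (ℤₚ.*-zeroʳ (sign (suc M)))))

alternating-nonzero : ∀ d {M} → d ≢ 0 → d ≤ M → ∑ℤ (upTo (suc M)) (λ ℓ → sign ℓ ℤ.* + (d C ℓ)) ≡ 0ℤ
alternating-nonzero zero        d≢0 _   = contradiction refl d≢0
alternating-nonzero (suc d) {M} _   d<M = trans (alternating-suc d M)
  (trans (cong (λ b → sign M ℤ.* + b) (k>n⇒nCk≡0 d<M)) (ℤₚ.*-zeroʳ (sign M)))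

-- For `c < k` the first binomial is 0, for `c = k` only `ℓ = 0` survives, and for `c > k` the
-- alternating row sum vanishes. Terms with `ℓ` beyond `c` are 0, so one cut-off serves all words,
-- whatever their number of cycles.
alternating-binomial : ∀ c k M → c ≤ M →
  ∑ℤ (upTo (suc M)) (λ ℓ → sign ℓ ℤ.* + ((c C k) * ((c ∸ k) C ℓ))) ≡ + 𝟙 (c ℕ.≟ k)
alternating-binomial c k M c≤M = begin
  ∑ℤ (upTo (suc M)) (λ ℓ → sign ℓ ℤ.* + ((c C k) * ((c ∸ k) C ℓ)))
    ≡⟨ ∑ℤ-cong (upTo (suc M)) (λ ℓ → trans (cong (sign ℓ ℤ.*_) (ℤₚ.pos-* (c C k) ((c ∸ k) C ℓ)))
         (rearrange (sign ℓ) (+ (c C k)) (+ ((c ∸ k) C ℓ)))) ⟩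
  ∑ℤ (upTo (suc M)) (λ ℓ → + (c C k) ℤ.* (sign ℓ ℤ.* + ((c ∸ k) C ℓ)))
    ≡⟨ ∑ℤ-*ˡ (upTo (suc M)) (+ (c C k)) _ ⟩
  + (c C k) ℤ.* ∑ℤ (upTo (suc M)) (λ ℓ → sign ℓ ℤ.* + ((c ∸ k) C ℓ))
    ≡⟨ evaluate ⟩
  + 𝟙 (c ℕ.≟ k) ∎
  where
  open ≡-Reasoning
  rearrange : ∀ s a b → s ℤ.* (a ℤ.* b) ≡ a ℤ.* (s ℤ.* b)
  rearrange = ℤ-Solver.solve-∀
  S : ℕ → ℤ
  S d = ∑ℤ (upTo (suc M)) (λ ℓ → sign ℓ ℤ.* + (d C ℓ))
  evaluate : + (c C k) ℤ.* S (c ∸ k) ≡ + 𝟙 (c ℕ.≟ k)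
  evaluate with c ℕ.≟ k
  ... | yes refl = cong₂ ℤ._*_ (cong +_ (nCn≡1 c)) (trans (cong S (n∸n≡0 c)) (alternating-zero M))
  ... | no c≢k with k ≤? c
  ... | no  k≰c = trans (cong (λ b → + b ℤ.* S (c ∸ k)) (k>n⇒nCk≡0 (≰⇒> k≰c))) (ℤₚ.*-zeroˡ (S (c ∸ k)))
  ... | yes k≤c = trans (cong (+ (c C k) ℤ.*_)
    (alternating-nonzero (c ∸ k) (λ c∸k≡0 → c≢k (≤-antisym (m∸n≡0⇒m≤n c∸k≡0) k≤c)) (≤-trans (m∸n≤m c k) c≤M)))
    (ℤₚ.*-zeroʳ (+ (c C k)))

-- Exchanges the signed sum over `ℓ` with the sum over words, so that an identity for each word
-- separately suffices.
∑ℤ-∑ : (ls : List B) (ε : B → ℤ) (ws : List A) (g : A → B → ℕ) (h : A → ℕ) →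
  (∀ w → ∑ℤ ls (λ ℓ → ε ℓ ℤ.* + g w ℓ) ≡ + h w) →
  ∑ℤ ls (λ ℓ → ε ℓ ℤ.* + (∑[ w ← ws ] g w ℓ)) ≡ + ∑ ws h
∑ℤ-∑ ls ε []       g h eq = ∑ℤ-0 ls (λ ℓ → ℤₚ.*-zeroʳ (ε ℓ))
∑ℤ-∑ ls ε (w ∷ ws) g h eq = begin
  ∑ℤ ls (λ ℓ → ε ℓ ℤ.* + (g w ℓ + (∑[ w ← ws ] g w ℓ)))
    ≡⟨ ∑ℤ-cong ls (λ ℓ → trans (cong (ε ℓ ℤ.*_) (ℤₚ.pos-+ (g w ℓ) _)) (ℤₚ.*-distribˡ-+ (ε ℓ) _ _)) ⟩
  ∑ℤ ls (λ ℓ → ε ℓ ℤ.* + g w ℓ ℤ.+ ε ℓ ℤ.* + (∑[ w ← ws ] g w ℓ))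
    ≡⟨ ∑ℤ-+ ls _ _ ⟩
  ∑ℤ ls (λ ℓ → ε ℓ ℤ.* + g w ℓ) ℤ.+ ∑ℤ ls (λ ℓ → ε ℓ ℤ.* + (∑[ w ← ws ] g w ℓ))
    ≡⟨ cong₂ ℤ._+_ (eq w) (∑ℤ-∑ ls ε ws g h eq) ⟩
  + h w ℤ.+ + ∑ ws h
    ≡⟨ ℤₚ.pos-+ (h w) _ ⟨
  + ∑ (w ∷ ws) h ∎
  where open ≡-Reasoning

-- Fractions

/-≡ : ∀ a b c d .{{_ : NonZero b}} .{{_ : NonZero d}} → a ℤ.* + d ≡ c ℤ.* + b → a / b ≡ c / d
/-≡ a (suc b) c (suc d) eq = fromℚᵘ-cong {mkℚᵘ a b} {mkℚᵘ c d} (*≡* eq)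

*-/ : ∀ a b c d .{{_ : NonZero b}} .{{_ : NonZero d}} →
  (a / b) ℚ.* (c / d) ≡ ((a ℤ.* c) / (b * d)) {{m*n≢0 b d}}
*-/ a (suc b) c (suc d) = toℚᵘ-injective (begin
  toℚᵘ ((a / suc b) ℚ.* (c / suc d))              ≈⟨ toℚᵘ-homo-* (a / suc b) (c / suc d) ⟩
  toℚᵘ (a / suc b) ℚᵘ.* toℚᵘ (c / suc d)
    ≈⟨ ℚᵘₚ.*-cong (toℚᵘ-fromℚᵘ (mkℚᵘ a b)) (toℚᵘ-fromℚᵘ (mkℚᵘ c d)) ⟩
  mkℚᵘ a b ℚᵘ.* mkℚᵘ c d                          ≈⟨ toℚᵘ-fromℚᵘ (mkℚᵘ a b ℚᵘ.* mkℚᵘ c d) ⟨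
  toℚᵘ ((a ℤ.* c) / (suc b * suc d))              ∎)
  where open ℚᵘₚ.≃-Reasoning

+-/1 : ∀ a b → (a / 1) ℚ.+ (b / 1) ≡ (a ℤ.+ b) / 1
+-/1 a b = toℚᵘ-injective (begin
  toℚᵘ ((a / 1) ℚ.+ (b / 1))           ≈⟨ toℚᵘ-homo-+ (a / 1) (b / 1) ⟩
  toℚᵘ (a / 1) ℚᵘ.+ toℚᵘ (b / 1)       ≈⟨ ℚᵘₚ.+-cong (toℚᵘ-fromℚᵘ (mkℚᵘ a 0)) (toℚᵘ-fromℚᵘ (mkℚᵘ b 0)) ⟩
  mkℚᵘ a 0 ℚᵘ.+ mkℚᵘ b 0               ≈⟨ *≡* (clear a b) ⟩
  mkℚᵘ (a ℤ.+ b) 0                     ≈⟨ toℚᵘ-fromℚᵘ (mkℚᵘ (a ℤ.+ b) 0) ⟨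
  toℚᵘ ((a ℤ.+ b) / 1)                 ∎)
  where
  open ℚᵘₚ.≃-Reasoning
  clear : ∀ a b → (a ℤ.* 1ℤ ℤ.+ b ℤ.* 1ℤ) ℤ.* 1ℤ ≡ (a ℤ.+ b) ℤ.* 1ℤ
  clear = ℤ-Solver.solve-∀

-- Terms outside the filter count as the integer 0; the rational sum over admissible `ℓ` thereby
-- becomes an integer sum over the full range, to which the alternating identity applies.
sumℚ-filter : {P : A → Set} (P? : Decidable P) (xs : List A) (q : A → ℚ) (z : A → ℤ) →
  (∀ x → P x → q x ≡ z x / 1) → (∀ x → ¬ P x → z x ≡ 0ℤ) →
  sumℚ (map q (filter P? xs)) ≡ ∑ℤ xs z / 1
sumℚ-filter P? []       q z on off = refl
sumℚ-filter P? (x ∷ xs) q z on off with P? x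
... | yes p = trans (cong₂ ℚ._+_ (on x p) (sumℚ-filter P? xs q z on off)) (+-/1 (z x) _)
... | no ¬p = trans (sumℚ-filter P? xs q z on off)
  (cong (_/ 1) (sym (trans (cong (ℤ._+ ∑ℤ xs z) (off x ¬p)) (ℤₚ.+-identityˡ (∑ℤ xs z)))))

-- The exponent is -1 when `s = n` and nonnegative otherwise. Describing the power as `p / q` with a
-- cross-multiplied equation lets both cases be treated alike.
^ℤ-fraction : ∀ b n s .{{_ : NonZero b}} → s ≤ n →
  ∃₂ λ p q → Σ[ q≢0 ∈ NonZero q ]
    b ^ℤ (+ n ℤ.- + s ℤ.- 1ℤ) ≡ ((+ p) / q) {{q≢0}} × p * b ≡ b ^ (n ∸ s) * q
^ℤ-fraction b n s s≤n rewrite ℤₚ.m-n≡m⊖n n s | ℤₚ.⊖-≥ s≤n with n ∸ s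
... | zero  = 1 , b ^ 1 , m^n≢0 b 1 , refl , exponent b
  where
  exponent : ∀ b → 1 * b ≡ 1 * (b * 1)
  exponent = solve-∀
... | suc r = b ^ r , 1 , _ , refl , trans (*-comm (b ^ r) b) (sym (*-identityʳ _))

product-! : ∀ j m r → product (map _! (replicate j m ++ List.[ r ])) ≡ (m !) ^ j * r !
product-! zero    m r = *-comm (r !) 1
product-! (suc j) m r = trans (cong (m ! *_) (product-! j m r)) (sym (*-assoc (m !) ((m !) ^ j) (r !)))

module _ (n μ k ℓ : ℕ) where
  private
    j = k + ℓ
    m = suc μ
    s = j * m

  -- As `m !` is `m * μ !`, dividing `(μ !) ^ j` by `(m !) ^ j` leaves `m ^ j` in the denominator.
  -- The hypothesis is the resulting equation for `G` with all denominators cleared.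
  summand-value : s ≤ n → (G : ℕ) →
    suc n * (m ^ j * (k ! * ℓ ! * G)) * (suc n ∸ s) ! ≡ (suc n) ! * suc n ^ (n ∸ s) →
    summand n m k ℓ ≡ (sign ℓ ℤ.* + G) / 1
  summand-value s≤n G count with ^ℤ-fraction (suc n) n s s≤n
  ... | p , q , q≢0 , power , pq = begin
    summand n m k ℓ
      ≡⟨ cong₂ ℚ._*_ (*-/ (sign ℓ ℤ.* + ((μ !) ^ j)) (k ! * ℓ !) (+ (suc n !)) (product fs)) power ⟩
    ((sign ℓ ℤ.* + ((μ !) ^ j)) ℤ.* + (suc n !)) / (k ! * ℓ ! * product fs) ℚ.* (+ p / q)
      ≡⟨ *-/ ((sign ℓ ℤ.* + ((μ !) ^ j)) ℤ.* + (suc n !)) (k ! * ℓ ! * product fs) (+ p) q ⟩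
    (((sign ℓ ℤ.* + ((μ !) ^ j)) ℤ.* + (suc n !)) ℤ.* + p) / (k ! * ℓ ! * product fs * q)
      ≡⟨ /-≡ (((sign ℓ ℤ.* + ((μ !) ^ j)) ℤ.* + (suc n !)) ℤ.* + p) (k ! * ℓ ! * product fs * q) (sign ℓ ℤ.* + G) 1 crossed ⟩
    (sign ℓ ℤ.* + G) / 1 ∎
    where
    open ≡-Reasoning
    fs = map _! (replicate j m ++ List.[ n ∸ s + 1 ])
    instance
      _ = q≢0
      _ = k !* ℓ !≢0
      fs≢0 : NonZero (product fs)
      fs≢0 = subst NonZero (sym (product-! j m (n ∸ s + 1))) (m*n≢0 ((m !) ^ j) ((n ∸ s + 1) !) {{m^n≢0 (m !) j {{m !≢0}}}} {{(n ∸ s + 1) !≢0}})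
      kℓ≢0 : NonZero (k ! * ℓ ! * product fs)
      kℓ≢0 = m*n≢0 (k ! * ℓ !) (product fs)
      den≢0 : NonZero (k ! * ℓ ! * product fs * q)
      den≢0 = m*n≢0 (k ! * ℓ ! * product fs) q
    ^-distrib-* : ∀ a b j → (a * b) ^ j ≡ a ^ j * b ^ j
    ^-distrib-* a b zero    = refl
    ^-distrib-* a b (suc j) = trans (cong (a * b *_) (^-distrib-* a b j)) (exchange a b (a ^ j) (b ^ j))
      where
      exchange : ∀ a b c d → a * b * (c * d) ≡ a * c * (b * d)
      exchange = solve-∀
    crossedℕ : (μ !) ^ j * suc n ! * p ≡ G * (k ! * ℓ ! * product fs * q)
    crossedℕ = *-cancelʳ-≡ _ _ (suc n) (begin
      (μ !) ^ j * suc n ! * p * suc n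
        ≡⟨ *-assoc ((μ !) ^ j * suc n !) p (suc n) ⟩
      (μ !) ^ j * suc n ! * (p * suc n)
        ≡⟨ cong ((μ !) ^ j * suc n ! *_) pq ⟩
      (μ !) ^ j * suc n ! * (suc n ^ (n ∸ s) * q)
        ≡⟨ regroup ((μ !) ^ j) (suc n !) (suc n ^ (n ∸ s)) q ⟩
      (μ !) ^ j * q * (suc n ! * suc n ^ (n ∸ s))
        ≡⟨ cong ((μ !) ^ j * q *_) count ⟨
      (μ !) ^ j * q * (suc n * (m ^ j * (k ! * ℓ ! * G)) * (suc n ∸ s) !)
        ≡⟨ collect ((μ !) ^ j) q (suc n) (m ^ j) (k ! * ℓ !) G ((suc n ∸ s) !) ⟩
      G * (k ! * ℓ ! * (m ^ j * (μ !) ^ j * (suc n ∸ s) !) * q) * suc n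
        ≡⟨ cong (λ f → G * (k ! * ℓ ! * f * q) * suc n) (begin
             m ^ j * (μ !) ^ j * (suc n ∸ s) !
               -- The last multinomial entry `n ∸ s + 1` is `suc n ∸ s`, the number of letters of
               -- the circle outside the cycles; this uses `s ≤ n`.
               ≡⟨ cong₂ (λ a r → a * r !) (sym (^-distrib-* m (μ !) j)) (trans (+-∸-assoc 1 s≤n) (+-comm 1 (n ∸ s))) ⟩
             (m !) ^ j * (n ∸ s + 1) !
               ≡⟨ product-! j m (n ∸ s + 1) ⟨
             product fs ∎) ⟩
      G * (k ! * ℓ ! * product fs * q) * suc n ∎)
      where
      regroup : ∀ a b c d → a * b * (c * d) ≡ a * d * (b * c)
      regroup = solve-∀
      collect : ∀ a q n m f g r → a * q * (n * (m * (f * g)) * r) ≡ g * (f * (m * a * r) * q) * n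
      collect = solve-∀
    crossed : (((sign ℓ ℤ.* + ((μ !) ^ j)) ℤ.* + (suc n !)) ℤ.* + p) ℤ.* 1ℤ ≡
              (sign ℓ ℤ.* + G) ℤ.* + (k ! * ℓ ! * product fs * q)
    crossed = begin
      (((sign ℓ ℤ.* + ((μ !) ^ j)) ℤ.* + (suc n !)) ℤ.* + p) ℤ.* 1ℤ
        ≡⟨ assoc (sign ℓ) (+ ((μ !) ^ j)) (+ (suc n !)) (+ p) ⟩
      sign ℓ ℤ.* (+ ((μ !) ^ j) ℤ.* + (suc n !) ℤ.* + p)
        ≡⟨ cong (sign ℓ ℤ.*_) (trans (cong (ℤ._* + p) (sym (ℤₚ.pos-* ((μ !) ^ j) (suc n !)))) (sym (ℤₚ.pos-* ((μ !) ^ j * suc n !) p))) ⟩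
      sign ℓ ℤ.* + ((μ !) ^ j * suc n ! * p)
        ≡⟨ cong (λ a → sign ℓ ℤ.* + a) crossedℕ ⟩
      sign ℓ ℤ.* + (G * (k ! * ℓ ! * product fs * q))
        ≡⟨ cong (sign ℓ ℤ.*_) (ℤₚ.pos-* G _) ⟩
      sign ℓ ℤ.* (+ G ℤ.* + (k ! * ℓ ! * product fs * q))
        ≡⟨ ℤₚ.*-assoc (sign ℓ) (+ G) _ ⟨
      (sign ℓ ℤ.* + G) ℤ.* + (k ! * ℓ ! * product fs * q) ∎
      where
      assoc : ∀ e a b c → (((e ℤ.* a) ℤ.* b) ℤ.* c) ℤ.* 1ℤ ≡ e ℤ.* (a ℤ.* b ℤ.* c)
      assoc = ℤ-Solver.solve-∀

-- Parking functions with a given number of cycles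

unique-length≤ : {v : Vec (Fin n) k} → V.Unique v → k ≤ n
unique-length≤ {v = v} v! = injective⇒≤ {f = Vec.lookup v} (Vₚ.lookup-injective v! _ _)

isParkingFunction? : (π : Vec ℕ n) → Dec (IsParkingFunction π)
isParkingFunction? π = map′ (λ (pos , #) → #⇒parking pos #) (λ p → proj₁ p , parking⇒# p)
  (VAll.all? (1 ≤?_) π ×-dec Fin.all? (λ i → toℕ i <? _))

module _ (μ : ℕ) where

  private
    m = suc μ

  #cycles : Vec ℕ n → ℕ
  #cycles π = proj₁ (cycles-cardinality π μ)

  #cycles-correct : (π : Vec ℕ n) → HasCardinality (Cycles m π) (#cycles π)
  #cycles-correct π = proj₁ (proj₂ (cycles-cardinality π μ))

  ∑-disjointCycles : (π : Vec ℕ n) (j : ℕ) →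
    ∑[ t ← vecs (vecs (allFin n) m) j ] 𝟙 (disjointFamily? (isCycle? π) t) ≡ m ^ j * #cycles π ↓ j
  ∑-disjointCycles π j =
    ∑-disjointFamily π j (#cycles π) (isCycle? π) (allCycles π) (proj₂ (proj₂ (cycles-cardinality π μ)))

  -- There are `m ^ c * c !` families listing all `c` cycles, a positive number, and any one of them
  -- concatenates to `c * m` distinct indices.
  #cycles-bound : (π : Vec ℕ n) → #cycles π * m ≤ n
  #cycles-bound {n} π with #cycles π * m ≤? n
  ... | yes le = le
  ... | no  ≰n = contradiction (begin
    m ^ c * c !              ≡⟨ cong (m ^ c *_) (trans (sym (↓-! {c} ≤-refl)) (trans (cong (λ d → c ↓ c * d !) (n∸n≡0 c)) (*-identityʳ (c ↓ c)))) ⟩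
    m ^ c * c ↓ c            ≡⟨ ∑-disjointCycles π c ⟨
    ∑[ t ← vecs (vecs (allFin n) m) c ] 𝟙 (disjointFamily? (isCycle? π) t)
      ≡⟨ ∑-none (disjointFamily? (isCycle? π)) (vecs (vecs (allFin n) m) c) (λ _ (ds , cs) →
           ≰n (unique-length≤ (VPairsₚ.concat⁺ (VAll.map proj₁ cs) ds))) ⟩
    0                        ∎)
    (≢-nonZero⁻¹ _ {{m*n≢0 (m ^ c) (c !) {{m^n≢0 m c}} {{c !≢0}}}})
    where
    open ≡-Reasoning
    c = #cycles π

  hasCycles? : (k : ℕ) (π : Vec ℕ n) → Dec (HasCardinality (Cycles m π) k)
  hasCycles? k π = map′ (λ { refl → #cycles-correct π })
    (cardinality-unique (Cycles m π) (#cycles-correct π)) (#cycles π ℕ.≟ k)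

  private
    words : (n : ℕ) → List (Vec (Fin (suc n)) n)
    words n = vecs (allFin (suc n)) n

    #w : Vec (Fin (suc n)) n → ℕ
    #w w = #cycles (values w)

  parkingCount : (n k : ℕ) → ℕ
  parkingCount n k = ∑[ w ← words n ] (𝟙 (park? w) * 𝟙 (#w w ℕ.≟ k))

  parkingCount-correct : (n k : ℕ) → 1 ≤ n → HasCardinality (ParkingFunctionsWithCycles n m k) (parkingCount n k)
  parkingCount-correct n k 1≤n = subst (HasCardinality (ParkingFunctionsWithCycles n m k)) count
    (representatives⇒cardinality (ParkingFunctionsWithCycles n m k) (select P? candidates)
      complete (select-! P? candidates!))
    where
    open ≡-Reasoning
    P? : (π : Vec ℕ n) → Dec (IsParkingFunction π × HasCardinality (Cycles m π) k)
    P? π = isParkingFunction? π ×-dec hasCycles? k π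
    candidates : List (Vec ℕ n)
    candidates = map values (words n)
    candidates! : Unique candidates
    candidates! = Uniq.map⁺ (V-map-injective (toℕ-injective ∘ ℕ.suc-injective) _ _) (vecs! (Uniq.allFin⁺ (suc n)) n)
    complete : ∀ x → Any (λ y → proj₁ x ≡ proj₁ y) (select P? candidates)
    complete (π , p) with parking-word 1≤n {π} (proj₁ p)
    ... | w , refl = ∈-select P? (∈-map⁺ values (∈-vecs ∈-allFin w)) p
    count : length (select P? candidates) ≡ parkingCount n k
    count = begin
      length (select P? candidates)        ≡⟨ length-select P? candidates ⟩
      ∑[ π ← candidates ] 𝟙 (P? π)         ≡⟨ ∑-map values (words n) _ ⟩
      ∑[ w ← words n ] 𝟙 (P? (values w))   ≡⟨ ∑-cong (words n) (λ w → trans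
        (𝟙-cong (P? (values w)) (park? w ×-dec (#w w ℕ.≟ k))
          (λ (p , h) → parking⇒park w p , cardinality-unique (Cycles m (values w)) (#cycles-correct (values w)) h)
          (λ { (p , refl) → park⇒parking w p , #cycles-correct (values w) }))
        (𝟙-× (park? w) _)) ⟩
      parkingCount n k                     ∎

  private
    -- For a parking word, the number of ways to choose `k` of its cycles and then `ℓ` of the
    -- others.
    weight : (k ℓ : ℕ) → Vec (Fin (suc n)) n → ℕ
    weight k ℓ w = 𝟙 (park? w) * ((#w w C k) * ((#w w ∸ k) C ℓ))

  ∑-weight : (n k ℓ : ℕ) → (k + ℓ) * m ≤ n →
    suc n * (m ^ (k + ℓ) * (k ! * ℓ ! * ∑ (words n) (weight k ℓ))) * (suc n ∸ (k + ℓ) * m) ! ≡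
    suc n ! * suc n ^ (n ∸ (k + ℓ) * m)
  ∑-weight n k ℓ s≤n = begin
    suc n * (m ^ j * (k ! * ℓ ! * ∑ (words n) (weight k ℓ))) * r !
      ≡⟨ cong (λ x → suc n * x * r !) (begin
           m ^ j * (k ! * ℓ ! * ∑ (words n) (weight k ℓ))
             ≡⟨ *-assoc (m ^ j) (k ! * ℓ !) _ ⟨
           m ^ j * (k ! * ℓ !) * ∑ (words n) (weight k ℓ)
             ≡⟨ ∑-*ˡ (words n) (m ^ j * (k ! * ℓ !)) (weight k ℓ) ⟨
           ∑[ w ← words n ] (m ^ j * (k ! * ℓ !) * weight k ℓ w)
             ≡⟨ ∑-cong (words n) (λ w → trans (falling w) (cong (𝟙 (park? w) *_) (sym (∑-disjointCycles (values w) j)))) ⟩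
           ∑[ w ← words n ] (𝟙 (park? w) * (∑[ t ← vecs (vecs (allFin n) m) j ] 𝟙 (disjointFamily? (isCycle? (values w)) t))) ∎) ⟩
    suc n * (∑[ w ← words n ] (𝟙 (park? w) * (∑[ t ← vecs (vecs (allFin n) m) j ] 𝟙 (disjointFamily? (isCycle? (values w)) t)))) * r !
      ≡⟨ cong (_* r !) (∑-park-disjointCycles n m j s≤n) ⟩
    U * suc n ^ (n ∸ j * m) * r !
      ≡⟨ exchange U (suc n ^ (n ∸ j * m)) (r !) ⟩
    U * r ! * suc n ^ (n ∸ j * m)
      ≡⟨ cong (_* suc n ^ (n ∸ j * m)) (∑-unique-vecs (suc n) (j * m) (m≤n⇒m≤1+n s≤n)) ⟩
    suc n ! * suc n ^ (n ∸ j * m) ∎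
    where
    open ≡-Reasoning
    j = k + ℓ
    r = suc n ∸ j * m
    U = ∑[ t ← vecs (allFin (suc n)) (j * m) ] 𝟙 (unique? t)
    exchange : ∀ a b c → a * b * c ≡ a * c * b
    exchange = solve-∀
    rearrange : ∀ M a b p c d → M * (a * b) * (p * (c * d)) ≡ p * (M * (c * a * (d * b)))
    rearrange = solve-∀
    falling : ∀ w → m ^ j * (k ! * ℓ !) * weight k ℓ w ≡ 𝟙 (park? w) * (m ^ j * #w w ↓ j)
    falling w = begin
      m ^ j * (k ! * ℓ !) * (𝟙 (park? w) * ((#w w C k) * ((#w w ∸ k) C ℓ)))
        ≡⟨ rearrange (m ^ j) (k !) (ℓ !) (𝟙 (park? w)) (#w w C k) ((#w w ∸ k) C ℓ) ⟩
      𝟙 (park? w) * (m ^ j * ((#w w C k) * k ! * (((#w w ∸ k) C ℓ) * ℓ !)))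
        ≡⟨ cong (λ x → 𝟙 (park? w) * (m ^ j * x)) (trans (↓-+ (#w w) k ℓ) (cong₂ _*_ (↓-C (#w w) k) (↓-C (#w w ∸ k) ℓ))) ⟨
      𝟙 (park? w) * (m ^ j * #w w ↓ j) ∎

  -- By `#cycles-bound` no word has `k + ℓ` cycles, so one of the two binomials vanishes.
  ∑-weight-zero : (n k ℓ : ℕ) → ¬ (k + ℓ) * m ≤ n → ∑ (words n) (weight k ℓ) ≡ 0
  ∑-weight-zero n k ℓ ≰n = trans (∑-cong (words n) λ w →
    trans (cong (𝟙 (park? w) *_) (vanish w)) (*-zeroʳ (𝟙 (park? w)))) (∑-0 (words n))
    where
    vanish : ∀ w → (#w w C k) * ((#w w ∸ k) C ℓ) ≡ 0
    vanish w with k ≤? #w w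
    ... | no  k≰c = cong (_* ((#w w ∸ k) C ℓ)) (k>n⇒nCk≡0 (≰⇒> k≰c))
    ... | yes k≤c = trans (cong ((#w w C k) *_) (k>n⇒nCk≡0 (+-cancelˡ-< k _ _
      (subst (_< k + ℓ) (sym (m+[n∸m]≡n k≤c)) (≰⇒> λ k+ℓ≤c →
        ≰n (≤-trans (*-monoˡ-≤ m k+ℓ≤c) (#cycles-bound (values w)))))))) (*-zeroʳ (#w w C k))

  parkingCount-formula : (n k : ℕ) →
    + parkingCount n k / 1 ≡ sumℚ (map (summand n m k) (filter (λ ℓ → (k + ℓ) * m ≤? n) (upTo (suc n))))
  parkingCount-formula n k = sym (begin
    sumℚ (map (summand n m k) (filter (λ ℓ → (k + ℓ) * m ≤? n) (upTo (suc n))))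
      ≡⟨ sumℚ-filter (λ ℓ → (k + ℓ) * m ≤? n) (upTo (suc n)) (summand n m k)
           (λ ℓ → sign ℓ ℤ.* + ∑ (words n) (weight k ℓ))
           (λ ℓ s≤n → summand-value n μ k ℓ s≤n _ (∑-weight n k ℓ s≤n))
           (λ ℓ ≰n → trans (cong (λ g → sign ℓ ℤ.* + g) (∑-weight-zero n k ℓ ≰n)) (ℤₚ.*-zeroʳ (sign ℓ))) ⟩
    ∑ℤ (upTo (suc n)) (λ ℓ → sign ℓ ℤ.* + ∑ (words n) (weight k ℓ)) / 1
      ≡⟨ cong (_/ 1) (∑ℤ-∑ (upTo (suc n)) sign (words n) (λ w ℓ → weight k ℓ w) _ per-word) ⟩
    + parkingCount n k / 1 ∎)
    where
    open ≡-Reasoning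
    rearrange : ∀ s p x → s ℤ.* (p ℤ.* x) ≡ p ℤ.* (s ℤ.* x)
    rearrange s p x = trans (sym (ℤₚ.*-assoc s p x)) (trans (cong (ℤ._* x) (ℤₚ.*-comm s p)) (ℤₚ.*-assoc p s x))
    per-word : ∀ w → ∑ℤ (upTo (suc n)) (λ ℓ → sign ℓ ℤ.* + weight k ℓ w) ≡ + (𝟙 (park? w) * 𝟙 (#w w ℕ.≟ k))
    per-word w = begin
      ∑ℤ (upTo (suc n)) (λ ℓ → sign ℓ ℤ.* + weight k ℓ w)
        ≡⟨ ∑ℤ-cong (upTo (suc n)) (λ ℓ → trans (cong (sign ℓ ℤ.*_) (ℤₚ.pos-* (𝟙 (park? w)) _)) (rearrange (sign ℓ) (+ 𝟙 (park? w)) _)) ⟩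
      ∑ℤ (upTo (suc n)) (λ ℓ → + 𝟙 (park? w) ℤ.* (sign ℓ ℤ.* + ((#w w C k) * ((#w w ∸ k) C ℓ))))
        ≡⟨ ∑ℤ-*ˡ (upTo (suc n)) (+ 𝟙 (park? w)) _ ⟩
      + 𝟙 (park? w) ℤ.* ∑ℤ (upTo (suc n)) (λ ℓ → sign ℓ ℤ.* + ((#w w C k) * ((#w w ∸ k) C ℓ)))
        -- Since `m` is positive, the number of cycles is at most `n`, so the range `upTo (suc n)`
        -- is long enough for every word.
        ≡⟨ cong (+ 𝟙 (park? w) ℤ.*_) (alternating-binomial (#w w) k n
             (≤-trans (m≤m*n (#w w) m) (#cycles-bound (values w)))) ⟩
      + 𝟙 (park? w) ℤ.* + 𝟙 (#w w ℕ.≟ k)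
        ≡⟨ ℤₚ.pos-* (𝟙 (park? w)) (𝟙 (#w w ℕ.≟ k)) ⟨
      + (𝟙 (park? w) * 𝟙 (#w w ℕ.≟ k)) ∎

theorem2p3 : (n m k : ℕ) → 1 ≤ n → 1 ≤ m → k * m ≤ n →
    Σ[ N ∈ ℕ ] (HasCardinality (ParkingFunctionsWithCycles n m k) N ×
    + N / 1 ≡ sumℚ (map (summand n m k) (filter (λ ℓ → (k + ℓ) * m ≤? n) (upTo (suc n)))))
theorem2p3 n (suc μ) k 1≤n _ _ =
  parkingCount μ n k , parkingCount-correct μ n k 1≤n , parkingCount-formula μ n k
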